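{- For every integer $k\ge 2$, the generating function $F_{12\text{ - }3\text{ - }\cdots\text{ - }k}(x,y)$ is given by the continued fraction $$F_{12\text{ - }3\text{ - }\cdots\text{ - }k}(x,y)=\cfrac{1}{1-x+xy^{d_1}-\cfrac{xy^{d_1}}{1-x+xy^{d_2}-\cfrac{xy^{d_2}}{1-x+xy^{d_3}-\cfrac{xy^{d_3}}{\cdots}}}},$$ where $d_i=\binom{i-1}{k-2}$ for $i\ge 1$, and $\binom ab$ is taken to be $0$ whenever $a<b$ or $b<0$.
   Context: Generalized patterns: a generalized pattern is a permutation $\tau=\tau_1\cdots\tau_k$ of $\{1,\dots,k\}$ written with dashes between some of its adjacent letters. An occurrence of $\tau$ in a permutation $\pi=\pi_1\cdots\pi_n\in S_n$ is a choice of positions $i_1<\dots<i_k$ such that $(\pi_{i_1},\dots,\pi_{i_k})$ is order-isomorphic to $(\tau_1,\dots,\tau_k)$ and $i_{j+1}=i_j+1$ whenever there is no dash between $\tau_j$ and $\tau_{j+1}$. The pattern $12\text{ - }3\text{ - }\cdots\text{ - }k$ thus requires only the first two letters to be adjacent in $\pi$ (for $k=2$ it is $12$). A permutation is $1\text{ - }3\text{ - }2$-avoiding if it has no occurrence of the (fully dashed, i.e. classical) pattern $1\text{ - }3\text{ - }2$. For a generalized pattern $\tau$, $f_{\tau;r}(n)$ is the number of $1\text{ - }3\text{ - }2$-avoiding permutations in $S_n$ containing exactly $r$ occurrences of $\tau$ (with $S_0$ consisting of the empty permutation), and $F_\tau(x,y)=\sum_{n,r\ge 0} f_{\tau;r}(n)x^ny^r$,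 viewed as a formal power series in $x$ with coefficients in $\mathbb Z[y]$. The infinite continued fraction is a formal power series in $x$: writing $A_i=1-x+xy^{d_i}-xy^{d_i}/A_{i+1}$, it is the $x$-adic limit as $m\to\infty$ of the finite fractions $1/A_1$ obtained by setting $A_m=1$. -}

module Defs where

open import Algebra.Bundles.Raw using (RawRing)
open import Data.Bool.Base using (Bool; true; false)
open import Data.Bool.Properties using () renaming (_≟_ to _≟ᵇ_)
open import Data.Fin.Base using (Fin; zero; suc; toℕ; inject₁; _<_)
open import Data.Fin.Patterns using (0F; 1F; 2F)
open import Data.Fin.Properties using (_<?_; _≟_; all?)
open import Data.Integer.Base as ℤ using (ℤ)
open import Data.List.Base as List using (List; []; _∷_; length; filter; foldr; applyUpTo; cartesianProductWith)
open import Data.List.Properties using (length-filter; filter-none)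
open import Data.List.Relation.Unary.All using (universal)
open import Data.Nat.Base as ℕ using (ℕ; zero; suc; pred; _∸_)
import Data.Nat.Properties as ℕₚ
open import Data.Product.Base using (_×_; _,_; ∃-syntax)
open import Data.Vec.Base as Vec using (Vec; []; _∷_; lookup; allFin)
open import Data.Vec.Relation.Unary.AllPairs using (allPairs?)
open import Data.Vec.Relation.Unary.Unique.Propositional using (Unique)
open import Data.Vec.Relation.Unary.Unique.Propositional.Properties using (tabulate⁺)
open import Function.Base using (id; _∘_)
open import Level using (0ℓ)
open import Relation.Binary.PropositionalEquality using (_≡_; refl; cong)
open import Relation.Nullary.Decidable using (¬?; _×-dec_; _→-dec_; from-yes)
open import Relation.Unary using (Decidable)

-- Permutations are words in one-line notation, over the alphabet Fin n
-- in place of {1,…,n}.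

words : ∀ n k → List (Vec (Fin n) k)
words n zero    = [] ∷ []
words n (suc k) = cartesianProductWith _∷_ (List.allFin n) (words n k)

unique? : ∀ {n k} → Decidable (Unique {A = Fin n} {k})
unique? = allPairs? (λ i j → ¬? (i ≟ j))

S : ∀ n → List (Vec (Fin n) n)
S n = filter unique? (words n n)

-- `dash g` tells whether there is a dash in the g-th gap, which lies
-- between the letters at `left g` and `right g`.

record Pattern (k : ℕ) : Set where
  field
    letters : Vec (Fin k) k
    unique  : Unique letters
    dash    : Fin (pred k) → Bool

left right : ∀ {k} → Fin (pred k) → Fin k
left  {suc k} = inject₁
right {suc k} = suc

Increasing : ∀ {n k} → Vec (Fin n) k → Set
Increasing is = ∀ a b → a < b → lookup is a < lookup is b

OrderIsomorphic : ∀ {m n k} → Vec (Fin m) k → Vec (Fin n) k → Set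
OrderIsomorphic u v = ∀ a b →
  (lookup u a < lookup u b → lookup v a < lookup v b) ×
  (lookup v a < lookup v b → lookup u a < lookup u b)

module _ {k n : ℕ} (τ : Pattern k) (π : Vec (Fin n) n) where
  open Pattern τ

  IsOccurrence : Vec (Fin n) k → Set
  IsOccurrence is =
    Increasing is ×
    OrderIsomorphic (Vec.map (lookup π) is) letters ×
    (∀ g → dash g ≡ false →
      toℕ (lookup is (right g)) ≡ suc (toℕ (lookup is (left g))))

  isOccurrence? : Decidable IsOccurrence
  isOccurrence? is =
    (all? λ a → all? λ b → (a <? b) →-dec (lookup is a <? lookup is b)) ×-dec
    (all? λ a → all? λ b →
      ((lookup v a <? lookup v b) →-dec (lookup letters a <? lookup letters b)) ×-dec
      ((lookup letters a <? lookup letters b) →-dec (lookup v a <? lookup v b))) ×-dec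
    (all? λ g → (dash g ≟ᵇ false) →-dec
      (toℕ (lookup is (right g)) ℕₚ.≟ suc (toℕ (lookup is (left g)))))
    where v = Vec.map (lookup π) is

  occurrences : ℕ
  occurrences = length (filter isOccurrence? (words n k))

pattern1-3-2 : Pattern 3
pattern1-3-2 = record
  { letters = 0F ∷ 2F ∷ 1F ∷ []
  ; unique  = from-yes (unique? (0F ∷ 2F ∷ 1F ∷ []))
  ; dash    = λ _ → true
  }

pattern12-3-⋯- : ∀ k → Pattern k
pattern12-3-⋯- k = record
  { letters = allFin k
  ; unique  = tabulate⁺ id
  ; dash    = λ g → 0 ℕ.<ᵇ toℕ g
  }

f : ∀ {k} → Pattern k → ℕ → ℕ → ℕ
f τ r n = length (filter (λ π → (occurrences pattern1-3-2 π ℕₚ.≟ 0) ×-dec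
                                (occurrences τ π ℕₚ.≟ r)) (S n))

-- A polynomial is its list of coefficients, constant term first.
-- Trailing zeros are allowed, so equality is equality of coefficients.

Poly : Set
Poly = List ℤ

coeff : Poly → ℕ → ℤ
coeff []      _       = ℤ.0ℤ
coeff (c ∷ p) zero    = c
coeff (c ∷ p) (suc r) = coeff p r

_+ₚ_ : Poly → Poly → Poly
[]      +ₚ q       = q
(c ∷ p) +ₚ []      = c ∷ p
(c ∷ p) +ₚ (d ∷ q) = (c ℤ.+ d) ∷ (p +ₚ q)

_*ₚ_ : Poly → Poly → Poly
[]      *ₚ q = []
(c ∷ p) *ₚ q = List.map (c ℤ.*_) q +ₚ (ℤ.0ℤ ∷ (p *ₚ q))

ℤ[y] : RawRing 0ℓ 0ℓ
ℤ[y] = record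
  { Carrier = Poly
  ; _≈_     = λ p q → ∀ r → coeff p r ≡ coeff q r
  ; _+_     = _+ₚ_
  ; _*_     = _*ₚ_
  ; -_      = List.map (λ c → ℤ.- c)
  ; 0#      = []
  ; 1#      = ℤ.1ℤ ∷ []
  }

y^ : ℕ → Poly
y^ zero    = ℤ.1ℤ ∷ []
y^ (suc d) = ℤ.0ℤ ∷ y^ d

module PowerSeries {c ℓ} (R : RawRing c ℓ) where
  open RawRing R

  Series : Set c
  Series = ℕ → Carrier

  sum : List Carrier → Carrier
  sum = foldr _+_ 0#

  const : Carrier → Series
  const a zero    = a
  const a (suc n) = 0#

  x : Series
  x (suc zero) = 1#
  x _          = 0#

  rawRing : RawRing c ℓ
  rawRing = record
    { Carrier = Series
    ; _≈_     = λ s t → ∀ n → s n ≈ t n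
    ; _+_     = λ s t n → s n + t n
    ; _*_     = λ s t n → sum (applyUpTo (λ j → s j * t (n ∸ j)) (suc n))
    ; -_      = λ s n → - s n
    ; 0#      = const 0#
    ; 1#      = const 1#
    }

  -- The inverse t of a series s with constant term 1, given by t₀ = 1 and
  -- tₙ₊₁ = - ∑_{j ≤ n} sⱼ₊₁ tₙ₋ⱼ.  For other s the value is meaningless.
  -- `recipUpTo s n` is the vector tₙ , tₙ₋₁ , … , t₀.

  recipUpTo : Series → ∀ n → Vec Carrier (suc n)
  recipUpTo s zero    = 1# ∷ []
  recipUpTo s (suc n) = (- sum (List.tabulate λ j → s (suc (toℕ j)) * lookup ts j)) ∷ ts
    where ts = recipUpTo s n

  recip : Series → Series
  recip s n = Vec.head (recipUpTo s n)

  -- Limit in the x-adic topology: for every N, eventually t ≡ s m modulo x^N.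

  _ConvergesTo_ : (ℕ → Series) → Series → Set ℓ
  s ConvergesTo t = ∀ N → ∃[ M ] ∀ m → M ℕ.≤ m → ∀ n → n ℕ.< N → s m n ≈ t n

open PowerSeries ℤ[y] using (Series; const; x; recip; _ConvergesTo_) public

-- Every r with f τ r n ≠ 0 is at most the number n ^ k of k-tuples of
-- positions, so the sum over r may stop there (see coeff-F).

F : ∀ {k} → Pattern k → Series
F {k} τ n = applyUpTo (λ r → ℤ.+ f τ r n) (suc (length (words n k)))

coeff-F : ∀ {k} (τ : Pattern k) n r → coeff (F τ n) r ≡ ℤ.+ f τ r n
coeff-F {k} τ n = coeff-applyUpTo _ _ f≡0
  where
  coeff-applyUpTo : ∀ g m → (∀ r → m ℕ.≤ r → g r ≡ ℤ.0ℤ) →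
                    ∀ r → coeff (applyUpTo g m) r ≡ g r
  coeff-applyUpTo g zero    g≡0 r       rewrite g≡0 r ℕ.z≤n = refl
  coeff-applyUpTo g (suc m) g≡0 zero    = refl
  coeff-applyUpTo g (suc m) g≡0 (suc r) =
    coeff-applyUpTo (g ∘ suc) m (λ r m≤r → g≡0 (suc r) (ℕ.s≤s m≤r)) r

  f≡0 : ∀ r → length (words n k) ℕ.< r → ℤ.+ f τ r n ≡ ℤ.0ℤ
  f≡0 r l<r = cong (ℤ.+_ ∘ length) (filter-none _ (universal none (S n)))
    where
    none = λ π → λ { (_ , refl) →
      ℕₚ.<⇒≱ l<r (length-filter (isOccurrence? τ π) (words n k)) }

module ContinuedFraction (d : ℕ → ℕ) where
  open RawRing (PowerSeries.rawRing ℤ[y])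

  -- The denominator A_i when A_{i + l} is set to 1.

  A : (l i : ℕ) → Series
  A zero    i = 1#
  A (suc l) i = 1# + - x + xy^d + - (xy^d * recip (A l (suc i)))
    where xy^d = x * const (y^ (d i))

  -- 1/A₁ when A_m is set to 1 (for m ≥ 1; the value at m = 0 does not
  -- affect the limit).

  finiteFraction : ℕ → Series
  finiteFraction m = recip (A (m ∸ 1) 1)

open ContinuedFraction using (finiteFraction) public

{-# OPTIONS --safe #-}
-- A 132-avoiding permutation is either empty or of the form l m r, where m is
-- its maximum, l and r avoid 132, and every letter of l exceeds every letter of
-- r; so these permutations are the binary trees.  Let e_j count the occurrences
-- of 12-3-⋯-(j+2).  An increasing subsequence cannot pass from l m to r, and m
-- can only end one, hence e_j (l m r) = e_j l + e_j r + e_{j-1} l for j > 0, and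
-- e_0 (l m r) = e_0 l + e_0 r + [l ≠ ∅].  By Pascal's rule the weights
--   w_q = ∑_j (q C (p − j)) e_j   satisfy
--   w_q (l m r) = [l ≠ ∅] (q C p) + w_{q+1} l + w_q r,
-- that is, G_q = ∑_π x^|π| y^(w_q π) satisfies
--   G_q = 1 + x G_q (1 + y^(q C p) (G_{q+1} − 1)),
-- which says G_q = 1 / A_{q+1}; and w_0 = e_p.

module Submission where

open import Algebra.Bundles.Raw using (RawRing)
open import Data.Bool.Base using (true; false; if_then_else_)
open import Data.Fin.Base using (Fin; zero; suc; toℕ; fromℕ<)
import Data.Fin.Base as Fin
open import Data.Fin.Patterns using (0F; 1F; 2F)
import Data.Fin.Properties as Finₚ
open import Data.Integer.Base as ℤ using (ℤ; 0ℤ; 1ℤ)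
import Data.Integer.Properties as ℤₚ
open import Data.Integer.Tactic.RingSolver using () renaming (solve-∀ to solve-∀ℤ)
open import Data.List.Base as List using (List; []; _∷_; _++_; applyUpTo; cartesianProductWith; concat; filter; length; tabulate)
open import Data.List.Membership.DecPropositional using () renaming (_∈?_ to _[_]∈?_)
open import Data.List.Membership.Propositional using (_∈_)
open import Data.List.Membership.Propositional.Properties
open import Data.List.Membership.Propositional.Properties.WithK using (unique∧set⇒bag)
open import Data.List.Properties using (filter-++; filter-none; filter-≐; length-++; length-map; length-tabulate; map-∘; tabulate-cong; tabulate-lookup; ∷-injective)
open import Data.List.Relation.Binary.BagAndSetEquality using (∼bag⇒↭)
open import Data.List.Relation.Binary.Permutation.Propositional.Properties using (↭-length)
open import Data.List.Relation.Unary.All as All using (All; []; _∷_)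
import Data.List.Relation.Unary.All.Properties as Allₚ
open import Data.List.Relation.Unary.AllPairs using (AllPairs; []; _∷_)
import Data.List.Relation.Unary.AllPairs.Properties as AllPairsₚ
open import Data.List.Relation.Unary.Any using (here)
open import Data.List.Relation.Unary.Unique.Propositional using (Unique)
import Data.List.Relation.Unary.Unique.Propositional.Properties as Uniqueₚ
open import Data.Nat.Base
open import Data.Nat.Combinatorics using (_C_; nCk+nC[k+1]≡[n+1]C[k+1]; k>n⇒nCk≡0)
open import Data.Nat.ListAction using (sum)
open import Data.Nat.Properties
open import Data.Nat.Tactic.RingSolver using (solve-∀)
open import Data.Product.Base using (_×_; _,_; proj₁; proj₂; ∃-syntax)
open import Data.Unit.Base using (⊤; tt)
open import Data.Vec.Base as Vec using (Vec; []; _∷_; lookup)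
import Data.Vec.Properties as Vecₚ
import Data.Vec.Relation.Unary.Unique.Propositional as VecUnique
import Data.Vec.Relation.Unary.Unique.Propositional.Properties as VecUniqueₚ
open import Defs
open import Function.Base using (_∘_; id)
open import Function.Bundles using (mk⇔)
open import Level using (0ℓ)
open import Relation.Binary.Bundles using (Setoid)
open import Relation.Binary.Definitions using (tri<; tri≈; tri>)
open import Relation.Binary.PropositionalEquality
import Relation.Binary.Reasoning.Setoid
open import Relation.Nullary.Decidable using (Dec; yes; no; does; _×-dec_; dec-true; dec-false)
open import Relation.Nullary.Negation using (¬_; contradiction)
open import Relation.Unary using (Decidable)

-- Counting occurrences

sum-tabulate-0 : ∀ {n} {t : Fin n → ℕ} → (∀ i → t i ≡ 0) → sum (tabulate t) ≡ 0
sum-tabulate-0 {zero}  t≡0 = refl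
sum-tabulate-0 {suc n} t≡0 = cong₂ _+_ (t≡0 zero) (sum-tabulate-0 (t≡0 ∘ suc))

sum-tabulate-cong : ∀ {n} {s t : Fin n → ℕ} → (∀ i → s i ≡ t i) → sum (tabulate s) ≡ sum (tabulate t)
sum-tabulate-cong = cong sum ∘ tabulate-cong

module _ {A : Set} where

  length-filter-⇔ : ∀ {P Q : A → Set} (P? : Decidable P) (Q? : Decidable Q) →
                    (∀ x → P x → Q x) → (∀ x → Q x → P x) →
                    ∀ xs → length (filter P? xs) ≡ length (filter Q? xs)
  length-filter-⇔ P? Q? f g xs = cong length (filter-≐ P? Q? ((λ {x} → f x) , (λ {x} → g x)) xs)

  length-filter-×-dec : ∀ {P : Set} {Q : A → Set} (P? : Dec P) (Q? : Decidable Q) xs →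
    length (filter (λ x → P? ×-dec Q? x) xs) ≡ (if does P? then length (filter Q? xs) else 0)
  length-filter-×-dec (yes p) Q? xs = length-filter-⇔ _ Q? (λ _ → proj₂) (λ _ → p ,_) xs
  length-filter-×-dec (no ¬p) Q? xs =
    cong length (filter-none _ (All.universal (λ _ → ¬p ∘ proj₁) xs))

length-filter-map : ∀ {A B : Set} {P : B → Set} (P? : Decidable P) (g : A → B) xs →
  length (filter P? (List.map g xs)) ≡ length (filter (P? ∘ g) xs)
length-filter-map P? g []       = refl
length-filter-map P? g (x ∷ xs) with does (P? (g x))
... | true  = cong suc (length-filter-map P? g xs)
... | false = length-filter-map P? g xs

length-filter-words : ∀ {n k} {P : Vec (Fin n) (suc k) → Set} (P? : Decidable P) →
  length (filter P? (words n (suc k))) ≡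
  sum (tabulate λ i → length (filter (P? ∘ (i ∷_)) (words n k)))
length-filter-words {n} {k} P? = go id
  where
  -- The alphabet is generalized to an arbitrary tabulated list, so that the induction can remove
  -- its first letter; `id` recovers all of `Fin n`.
  go : ∀ {m} (h : Fin m → Fin n) →
    length (filter P? (cartesianProductWith _∷_ (tabulate h) (words n k))) ≡
    sum (tabulate λ i → length (filter (P? ∘ (h i ∷_)) (words n k)))
  go {zero}  h = refl
  go {suc m} h = begin
    length (filter P? (xs ++ ys))                      ≡⟨ cong length (filter-++ P? xs ys) ⟩
    length (filter P? xs ++ filter P? ys)              ≡⟨ length-++ (filter P? xs) ⟩
    length (filter P? xs) + length (filter P? ys)      ≡⟨ cong₂ _+_ (length-filter-map P? _ (words n k)) (go (h ∘ suc)) ⟩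
    _ ∎
    where
    open ≡-Reasoning
    xs = List.map (h zero ∷_) (words n k)
    ys = cartesianProductWith _∷_ (tabulate (h ∘ suc)) (words n k)

∈-words : ∀ {n k} (v : Vec (Fin n) k) → v ∈ words n k
∈-words []      = here refl
∈-words (i ∷ v) = ∈-cartesianProductWith⁺ _∷_ (∈-allFin i) (∈-words v)

module _ {n} (g : Fin n → ℕ) where

  -- The recursive form of an occurrence of a fully dashed increasing pattern. The bounds `q` and
  -- `a` record the last position and value chosen, so that one position can be peeled off at a
  -- time.
  Chain : ∀ {k} → ℕ → ℕ → Vec (Fin n) k → Set
  Chain q a []       = ⊤
  Chain q a (i ∷ is) = q ≤ toℕ i × a < g i × Chain (suc (toℕ i)) (g i) is

  chain? : ∀ {k} q a → Decidable (Chain {k} q a)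
  chain? q a []       = yes tt
  chain? q a (i ∷ is) = (q ≤? toℕ i) ×-dec (a <? g i) ×-dec chain? _ _ is

  chains : ℕ → ℕ → ℕ → ℕ
  chains k q a = length (filter (chain? q a) (words n k))

  chains-suc : ∀ k q a → chains (suc k) q a ≡
    sum (tabulate λ i → if q ≤ᵇ toℕ i then if a <ᵇ g i then chains k (suc (toℕ i)) (g i) else 0 else 0)
  chains-suc k q a = trans (length-filter-words (chain? q a)) (sum-tabulate-cong λ i →
    trans (length-filter-×-dec (q ≤? toℕ i) (λ is → (a <? g i) ×-dec chain? _ _ is) (words n k))
          (cong (if q ≤ᵇ toℕ i then_else 0) (length-filter-×-dec (a <? g i) (chain? _ _) (words n k))))

  chain-lookup : ∀ {k q a} {is : Vec (Fin n) k} → Chain q a is → ∀ b → q ≤ toℕ (lookup is b) × a < g (lookup is b)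
  chain-lookup {is = i ∷ is} (q≤i , a<gi , c) zero    = q≤i , a<gi
  chain-lookup {is = i ∷ is} (q≤i , a<gi , c) (suc b) with i<j , gi<gj ← chain-lookup c b =
    ≤-trans q≤i (<⇒≤ i<j) , <-trans a<gi gi<gj

  chain⁻ : ∀ {k i} {is : Vec (Fin n) k} → Chain (suc (toℕ i)) (g i) is →
           ∀ a b → a Fin.< b → lookup (i ∷ is) a Fin.< lookup (i ∷ is) b × g (lookup (i ∷ is) a) < g (lookup (i ∷ is) b)
  chain⁻ c               zero    (suc b) _         = chain-lookup c b
  chain⁻ {is = _ ∷ _} (_ , _ , c) (suc a) (suc b) (s≤s a<b) = chain⁻ c a b a<b

  chain⁺ : ∀ {k i} {is : Vec (Fin n) k} →
           (∀ a b → a Fin.< b → lookup (i ∷ is) a Fin.< lookup (i ∷ is) b × g (lookup (i ∷ is) a) < g (lookup (i ∷ is) b)) →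
           Chain (suc (toℕ i)) (g i) is
  chain⁺ {is = []}    h = tt
  chain⁺ {is = _ ∷ _} h with i<j , gi<gj ← h zero (suc zero) (s≤s z≤n) =
    i<j , gi<gj , chain⁺ (λ a b a<b → h (suc a) (suc b) (s≤s a<b))

≤ᵇ-suc : ∀ m n → (suc m ≤ᵇ suc n) ≡ (m ≤ᵇ n)
≤ᵇ-suc zero    n = refl
≤ᵇ-suc (suc m) n = refl

chains-shift : ∀ {n} (g : Fin (suc n) → ℕ) k q a → chains g k (suc q) a ≡ chains (g ∘ suc) k q a
chains-shift g zero    q a = refl
chains-shift g (suc k) q a = begin
  chains g (suc k) (suc q) a  ≡⟨ chains-suc g k (suc q) a ⟩
  sum (tabulate (term ∘ suc)) ≡⟨ sum-tabulate-cong (λ i →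
      cong₂ (λ b m → if b then if a <ᵇ g (suc i) then m else 0 else 0)
            (≤ᵇ-suc q (toℕ i)) (chains-shift g k (suc (toℕ i)) (g (suc i)))) ⟩
  _                           ≡⟨ chains-suc (g ∘ suc) k q a ⟨
  chains (g ∘ suc) (suc k) q a ∎
  where
  open ≡-Reasoning
  term : Fin _ → ℕ
  term i = if suc q ≤ᵇ toℕ i then if a <ᵇ g i then chains g k (suc (toℕ i)) (g i) else 0 else 0

-- The number of increasing subsequences of length `k` with all letters above `a`: the first letter
-- of the word is either taken or skipped.
increasing : ℕ → ℕ → List ℕ → ℕ
increasing zero    a w       = 1
increasing (suc k) a []      = 0
increasing (suc k) a (x ∷ w) = (if a <ᵇ x then increasing k x w else 0) + increasing (suc k) a w

chains≡increasing : ∀ {n} (g : Fin n → ℕ) k a → chains g k 0 a ≡ increasing k a (tabulate g)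
chains≡increasing         g zero    a = refl
chains≡increasing {zero}  g (suc k) a = refl
chains≡increasing {suc n} g (suc k) a = begin
  chains g (suc k) 0 a
    ≡⟨ chains-suc g k 0 a ⟩
  (if a <ᵇ g zero then chains g k 1 (g zero) else 0) +
  sum (tabulate λ i → if a <ᵇ g (suc i) then chains g k (2 + toℕ i) (g (suc i)) else 0)
    ≡⟨ cong₂ _+_
         (cong (if a <ᵇ g zero then_else 0) (trans (chains-shift g k 0 _) (chains≡increasing (g ∘ suc) k _)))
         (sum-tabulate-cong λ i → cong (if a <ᵇ g (suc i) then_else 0) (chains-shift g k (suc (toℕ i)) _)) ⟩
  (if a <ᵇ g zero then increasing k (g zero) (tabulate (g ∘ suc)) else 0) +
  sum (tabulate λ i → if a <ᵇ g (suc i) then chains (g ∘ suc) k (suc (toℕ i)) (g (suc i)) else 0)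
    ≡⟨ cong (first +_) (chains-suc (g ∘ suc) k 0 a) ⟨
  first + chains (g ∘ suc) (suc k) 0 a
    ≡⟨ cong (first +_) (chains≡increasing (g ∘ suc) (suc k) a) ⟩
  increasing (suc k) a (tabulate g) ∎
  where
  open ≡-Reasoning
  first = if a <ᵇ g zero then increasing k (g zero) (tabulate (g ∘ suc)) else 0

-- The pattern counted by occ12 k, and by occᵗ k below, is 12-3-⋯-(k+2).

occ12 : ℕ → List ℕ → ℕ
occ12 k []          = 0
occ12 k (x ∷ [])    = 0
occ12 k (x ∷ y ∷ w) = (if x <ᵇ y then increasing k y w else 0) + occ12 k (y ∷ w)

adjacentChains : ∀ {n} → (Fin n → ℕ) → ℕ → ℕ
adjacentChains g k = sum (tabulate λ i → sum (tabulate λ j →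
  if toℕ j ≡ᵇ suc (toℕ i) then if g i <ᵇ g j then chains g k (suc (toℕ j)) (g j) else 0 else 0))

adjacentChains≡occ12 : ∀ {n} (g : Fin n → ℕ) k → adjacentChains g k ≡ occ12 k (tabulate g)
adjacentChains≡occ12 {zero}  g k = refl
adjacentChains≡occ12 {suc zero} g k = refl
-- For `i = 0` only `j = 1` passes the adjacency test. For `i > 0` the index `j = 0` fails it, so
-- both indices shift down together.
adjacentChains≡occ12 {suc (suc n)} g k = cong₂ _+_
  (trans (cong₂ _+_
    (cong (if g zero <ᵇ g (suc zero) then_else 0)
      (trans (chains-shift g k 1 _) (trans (chains-shift (g ∘ suc) k 0 _) (chains≡increasing (λ j → g (suc (suc j))) k _))))
    (sum-tabulate-0 {t = λ (_ : Fin n) → 0} (λ _ → refl))) (+-identityʳ _))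
  (trans (sum-tabulate-cong {n = suc n} λ i → sum-tabulate-cong {n = suc n} λ j →
           cong (λ m → if toℕ j ≡ᵇ suc (toℕ i) then if g (suc i) <ᵇ g (suc j) then m else 0 else 0)
                (chains-shift g k (suc (toℕ j)) (g (suc j))))
         (adjacentChains≡occ12 (g ∘ suc) k))

values : ∀ {n} → Vec (Fin n) n → List ℕ
values π = tabulate (toℕ ∘ lookup π)

module _ {n} (π : Vec (Fin n) n) (k : ℕ) where

  private
    g : Fin n → ℕ
    g = toℕ ∘ lookup π
    τ = pattern12-3-⋯- (suc (suc k))

  AdjacentChain : Vec (Fin n) (suc (suc k)) → Set
  AdjacentChain (i ∷ j ∷ is) = toℕ j ≡ suc (toℕ i) × g i < g j × Chain g (suc (toℕ j)) (g j) is

  adjacentChain? : Decidable AdjacentChain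
  adjacentChain? (i ∷ j ∷ is) = (toℕ j ≟ suc (toℕ i)) ×-dec (g i <? g j) ×-dec chain? g _ _ is

  -- The letters of the pattern are in increasing order, so order isomorphism makes the chosen
  -- values increase along the positions; the one gap without a dash gives the adjacency.
  occurrence⇒adjacentChain : ∀ is → IsOccurrence τ π is → AdjacentChain is
  occurrence⇒adjacentChain (i ∷ j ∷ is) (pos , iso , adj) =
    adj zero refl , proj₂ (h 0F 1F (s≤s z≤n)) , chain⁺ g (λ a b a<b → h (suc a) (suc b) (s≤s a<b))
    where
    h : ∀ a b → a Fin.< b → lookup (i ∷ j ∷ is) a Fin.< lookup (i ∷ j ∷ is) b × g (lookup (i ∷ j ∷ is) a) < g (lookup (i ∷ j ∷ is) b)
    h a b a<b = pos a b a<b ,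
      subst₂ _<_ (cong toℕ (Vecₚ.lookup-map a (lookup π) (i ∷ j ∷ is))) (cong toℕ (Vecₚ.lookup-map b (lookup π) (i ∷ j ∷ is)))
        (proj₂ (iso a b) (subst₂ Fin._<_ (sym (Vecₚ.lookup-allFin a)) (sym (Vecₚ.lookup-allFin b)) a<b))

  adjacentChain⇒occurrence : ∀ is → AdjacentChain is → IsOccurrence τ π is
  adjacentChain⇒occurrence (i ∷ j ∷ is) (j≡1+i , gi<gj , c) =
    (λ a b a<b → proj₁ (h a b a<b)) , iso , adj
    where
    v = i ∷ j ∷ is
    h : ∀ a b → a Fin.< b → lookup v a Fin.< lookup v b × g (lookup v a) < g (lookup v b)
    h = chain⁻ g (≤-reflexive (sym j≡1+i) , gi<gj , c)
    -- By trichotomy, a strictly increasing map also reflects the order, which is the other half of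
    -- order isomorphism.
    iso′ : ∀ a b → g (lookup v a) < g (lookup v b) → a Fin.< b
    iso′ a b ga<gb with Finₚ.<-cmp a b
    ... | tri< a<b _ _  = a<b
    ... | tri≈ _ refl _ = contradiction ga<gb (<-irrefl refl)
    ... | tri> _ _ b<a  = contradiction ga<gb (<-asym (proj₂ (h b a b<a)))
    iso : OrderIsomorphic (Vec.map (lookup π) v) (Pattern.letters τ)
    iso a b rewrite Vecₚ.lookup-map a (lookup π) v | Vecₚ.lookup-map b (lookup π) v | Vecₚ.lookup-allFin a | Vecₚ.lookup-allFin b =
      iso′ a b , λ a<b → proj₂ (h a b a<b)
    adj : ∀ d → Pattern.dash τ d ≡ false → toℕ (lookup v (right d)) ≡ suc (toℕ (lookup v (left d)))
    adj zero    _ = j≡1+i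

  occurrences≡occ12 : occurrences τ π ≡ occ12 k (values π)
  occurrences≡occ12 = begin
    occurrences τ π
      ≡⟨ length-filter-⇔ (isOccurrence? τ π) adjacentChain? occurrence⇒adjacentChain adjacentChain⇒occurrence (words n _) ⟩
    length (filter adjacentChain? (words n _))
      ≡⟨ length-filter-words adjacentChain? ⟩
    _ ≡⟨ sum-tabulate-cong (λ i → length-filter-words (adjacentChain? ∘ (i ∷_))) ⟩
    _ ≡⟨ sum-tabulate-cong (λ i → sum-tabulate-cong λ j →
           trans (length-filter-×-dec (toℕ j ≟ suc (toℕ i)) (λ is → (g i <? g j) ×-dec chain? g _ _ is) (words n k))
                 (cong (if toℕ j ≡ᵇ suc (toℕ i) then_else 0) (length-filter-×-dec (g i <? g j) (chain? g _ _) (words n k)))) ⟩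
    adjacentChains g k
      ≡⟨ adjacentChains≡occ12 g k ⟩
    occ12 k (values π) ∎
    where open ≡-Reasoning

-- Avoidance of 1-3-2 as a property of words

-- For `x` before `y` before `z`, the excluded inequalities are those of an occurrence of 1-3-2.
-- Fixing `x` leaves a binary relation, to be imposed on all pairs of later letters.
No32Above : ℕ → ℕ → ℕ → Set
No32Above x y z = ¬ (x < z × z < y)

Avoids132 : List ℕ → Set
Avoids132 []      = ⊤
Avoids132 (x ∷ w) = AllPairs (No32Above x) w × Avoids132 w

AllPairs-tabulate⁻ : ∀ {A : Set} {R : A → A → Set} {n} (g : Fin n → A) → AllPairs R (tabulate g) →
                     ∀ a b → a Fin.< b → R (g a) (g b)
AllPairs-tabulate⁻ g (r ∷ rs) zero    (suc b) _         = Allₚ.tabulate⁻ r b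
AllPairs-tabulate⁻ g (r ∷ rs) (suc a) (suc b) (s≤s a<b) = AllPairs-tabulate⁻ (g ∘ suc) rs a b a<b

avoids⁺ : ∀ {n} (g : Fin n → ℕ) → (∀ a b c → a Fin.< b → b Fin.< c → No32Above (g a) (g b) (g c)) → Avoids132 (tabulate g)
avoids⁺ {zero}  g h = tt
avoids⁺ {suc n} g h =
  AllPairsₚ.tabulate⁺-< (λ {b} {c} b<c → h zero (suc b) (suc c) (s≤s z≤n) (s≤s b<c)) ,
  avoids⁺ (g ∘ suc) (λ a b c a<b b<c → h (suc a) (suc b) (suc c) (s≤s a<b) (s≤s b<c))

avoids⁻ : ∀ {n} (g : Fin n → ℕ) → Avoids132 (tabulate g) → ∀ a b c → a Fin.< b → b Fin.< c → No32Above (g a) (g b) (g c)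
avoids⁻ g (r , _)  zero    (suc b) (suc c) _         (s≤s b<c) = AllPairs-tabulate⁻ (g ∘ suc) r b c b<c
avoids⁻ g (_ , rs) (suc a) (suc b) (suc c) (s≤s a<b) (s≤s b<c) = avoids⁻ (g ∘ suc) rs a b c a<b b<c

module _ {n} (π : Vec (Fin n) n) where

  occurrence132 : ∀ a b c → a Fin.< b → b Fin.< c → lookup π a Fin.< lookup π c → lookup π c Fin.< lookup π b →
                  IsOccurrence pattern1-3-2 π (a ∷ b ∷ c ∷ [])
  occurrence132 a b c a<b b<c x<z z<y = increases , iso , λ _ ()
    where
    x<y = <-trans x<z z<y
    increases : Increasing (a ∷ b ∷ c ∷ [])
    increases 0F 1F _ = a<b
    increases 0F 2F _ = <-trans a<b b<c
    increases 1F 2F _ = b<c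
    increases 1F 1F (s≤s ())
    increases 2F 1F (s≤s ())
    increases 2F 2F (s≤s (s≤s ()))
    iso : OrderIsomorphic (Vec.map (lookup π) (a ∷ b ∷ c ∷ [])) (Pattern.letters pattern1-3-2)
    iso 0F 0F = (λ p → contradiction p (<-irrefl refl)) , λ p → contradiction p (<-irrefl refl)
    iso 0F 1F = (λ _ → s≤s z≤n) , λ _ → x<y
    iso 0F 2F = (λ _ → s≤s z≤n) , λ _ → x<z
    iso 1F 0F = (λ p → contradiction p (<-asym x<y)) , λ ()
    iso 1F 1F = (λ p → contradiction p (<-irrefl refl)) , λ p → contradiction p (<-irrefl refl)
    iso 1F 2F = (λ p → contradiction p (<-asym z<y)) , λ { (s≤s ()) }
    iso 2F 0F = (λ p → contradiction p (<-asym x<z)) , λ ()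
    iso 2F 1F = (λ _ → s≤s (s≤s z≤n)) , λ _ → z<y
    iso 2F 2F = (λ p → contradiction p (<-irrefl refl)) , λ p → contradiction p (<-irrefl refl)

  occurrences132≡0⇒avoids : occurrences pattern1-3-2 π ≡ 0 → Avoids132 (values π)
  occurrences132≡0⇒avoids none = avoids⁺ _ λ a b c a<b b<c (x<z , z<y) →
    empty none (∈-filter⁺ (isOccurrence? pattern1-3-2 π) (∈-words (a ∷ b ∷ c ∷ [])) (occurrence132 a b c a<b b<c x<z z<y))
    where
    empty : ∀ {A : Set} {xs : List A} {x} → length xs ≡ 0 → ¬ (x ∈ xs)
    empty {xs = []} _ ()

  avoids⇒occurrences132≡0 : Avoids132 (values π) → occurrences pattern1-3-2 π ≡ 0
  avoids⇒occurrences132≡0 av = cong length (filter-none (isOccurrence? pattern1-3-2 π) (All.universal none (words n 3)))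
    where
    none : ∀ is → ¬ IsOccurrence pattern1-3-2 π is
    none (a ∷ b ∷ c ∷ []) (pos , iso , _) = avoids⁻ _ av a b c (pos 0F 1F (s≤s z≤n)) (pos 1F 2F (s≤s (s≤s z≤n)))
      (proj₂ (iso 0F 2F) (s≤s z≤n) , proj₂ (iso 2F 1F) (s≤s (s≤s z≤n)))

-- Binary trees

data Tree : Set where
  leaf : Tree
  node : Tree → Tree → Tree

size : Tree → ℕ
size leaf       = 0
size (node l r) = suc (size l + size r)

-- The letters of word b t are b, …, b + size t − 1.

word : ℕ → Tree → List ℕ
word b leaf       = []
word b (node l r) = word (size r + b) l ++ (size l + (size r + b)) ∷ word b r

-- Applied to the size of `l`, this is the bracket `[l ≠ ∅]`: an ascent leads into the maximum
-- exactly when some letter precedes it.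
sgn : ℕ → ℕ
sgn zero    = 0
sgn (suc _) = 1

occᵗ : ℕ → Tree → ℕ
occᵗ k       leaf       = 0
occᵗ zero    (node l r) = occᵗ 0 l + occᵗ 0 r + sgn (size l)
occᵗ (suc k) (node l r) = occᵗ (suc k) l + occᵗ (suc k) r + occᵗ k l

-- weight q p = ∑_j (q C (p − j)) e_j, with Pascal's rule as the definition.

weight : ℕ → ℕ → Tree → ℕ
weight zero    p       t = occᵗ p t
weight (suc q) zero    t = weight q zero t
weight (suc q) (suc p) t = weight q (suc p) t + weight q p t

weight-leaf : ∀ q p → weight q p leaf ≡ 0
weight-leaf zero    p       = refl
weight-leaf (suc q) zero    = weight-leaf q zero
weight-leaf (suc q) (suc p) = cong₂ _+_ (weight-leaf q (suc p)) (weight-leaf q p)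

-- Induction on `q`: the identities for `suc p` and `p` add up, and Pascal's rule merges their
-- binomials. For `q = 0` the bracket survives only at `p = 0`, as `0 C p` vanishes otherwise, and
-- `weight 1` of `l` absorbs the count of the shorter pattern.
weight-node : ∀ q p l r → weight q p (node l r) ≡ sgn (size l) * (q C p) + weight (suc q) p l + weight q p r
weight-node zero zero l r = lemma (occᵗ 0 l) (occᵗ 0 r) (sgn (size l))
  where
  lemma : ∀ x y s → x + y + s ≡ s * 1 + x + y
  lemma = solve-∀
weight-node zero (suc p) l r rewrite k>n⇒nCk≡0 {0} {suc p} (s≤s z≤n) =
  lemma (occᵗ (suc p) l) (occᵗ (suc p) r) (occᵗ p l) (sgn (size l))
  where
  lemma : ∀ x y z s → x + y + z ≡ s * 0 + (x + z) + y
  lemma = solve-∀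
weight-node (suc q) zero l r = weight-node q zero l r
weight-node (suc q) (suc p) l r
  rewrite weight-node q (suc p) l r | weight-node q p l r | sym (nCk+nC[k+1]≡[n+1]C[k+1] q p) =
  lemma (sgn (size l)) (q C p) (q C suc p) (weight (suc q) (suc p) l) (weight (suc q) p l) _ _
  where
  lemma : ∀ s c d x y z w → s * d + x + z + (s * c + y + w) ≡ s * (c + d) + (x + y) + (z + w)
  lemma = solve-∀

-- Words of trees are 132-avoiding permutations

Within : ℕ → ℕ → List ℕ → Set
Within a b = All (λ x → a ≤ x × x < b)

Within-⊆ : ∀ {a b c d} → c ≤ a → b ≤ d → ∀ {w} → Within a b w → Within c d w
Within-⊆ c≤a b≤d = All.map λ (a≤x , x<b) → ≤-trans c≤a a≤x , <-≤-trans x<b b≤d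

length-word : ∀ b t → length (word b t) ≡ size t
length-word b leaf       = refl
length-word b (node l r) = begin
  length (word (size r + b) l ++ _ ∷ word b r)            ≡⟨ length-++ (word (size r + b) l) ⟩
  length (word (size r + b) l) + suc (length (word b r))  ≡⟨ cong₂ (λ x y → x + suc y) (length-word _ l) (length-word b r) ⟩
  size l + suc (size r)                                   ≡⟨ +-suc (size l) (size r) ⟩
  suc (size l + size r) ∎
  where open ≡-Reasoning

word-within : ∀ b t → Within b (size t + b) (word b t)
word-within b leaf       = []
word-within b (node l r) = Allₚ.++⁺
  (Within-⊆ (m≤n+m b (size r)) (m≤n⇒m≤1+n top) (word-within (size r + b) l))
  ((≤-trans (m≤n+m b (size r)) (m≤n+m _ (size l)) , s≤s top) ∷
   Within-⊆ ≤-refl (m≤n⇒m≤1+n (+-monoˡ-≤ b (m≤n+m (size r) (size l)))) (word-within b r))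
  where
  top : size l + (size r + b) ≤ size l + size r + b
  top = ≤-reflexive (sym (+-assoc (size l) (size r) b))

-- The order relations of a 132-avoiding word `l m r` with maximum `m`. The bound `r<m` is a
-- separate field because `l` may be empty.
record Split (l : List ℕ) (m : ℕ) (r : List ℕ) : Set where
  constructor split
  field
    l<m : All (_< m) l
    r<l : All (λ x → All (_< x) r) l
    r<m : All (_< m) r
open Split

Split-tail : ∀ {x l m r} → Split (x ∷ l) m r → Split l m r
Split-tail (split (_ ∷ l<m) (_ ∷ r<l) r<m) = split l<m r<l r<m

within⇒split : ∀ {a b c l r} → Within b c l → Within a b r → b ≤ c → Split l c r
within⇒split lw rw b≤c = split
  (All.map proj₂ lw)
  (All.map (λ (b≤x , _) → All.map (λ (_ , z<b) → <-≤-trans z<b b≤x) rw) lw)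
  (All.map (λ (_ , z<b) → <-≤-trans z<b b≤c) rw)

word-split : ∀ b l r → Split (word (size r + b) l) (size l + (size r + b)) (word b r)
word-split b l r = within⇒split (word-within _ l) (word-within b r) (m≤n+m _ (size l))

unique-++ : ∀ {l m r} → Split l m r → Unique l → Unique r → Unique (l ++ m ∷ r)
unique-++ (split l<m r<l r<m) ul ur = AllPairsₚ.++⁺ ul (All.map >⇒≢ r<m ∷ ur)
  (All.zipWith (λ (x<m , r<x) → <⇒≢ x<m ∷ All.map >⇒≢ r<x) (l<m , r<l))

word-unique : ∀ b t → Unique (word b t)
word-unique b leaf       = []
word-unique b (node l r) = unique-++ (word-split b l r) (word-unique _ l) (word-unique b r)

No32Above-below : ∀ {x r} → All (_< x) r → AllPairs (No32Above x) r
No32Above-below []        = []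
No32Above-below (_ ∷ r<x) = All.map (λ z<x (x<z , _) → <-asym x<z z<x) r<x ∷ No32Above-below r<x

-- A 1-3-2 starting at `x` in `l` has its last letter above `x`, hence not in `r`, and below its
-- middle letter, hence different from `m`; so it lies within `l`. None starts at `m`, which exceeds
-- all of `r`.
avoids-++ : ∀ {l m r} → Split l m r → Avoids132 l → Avoids132 r → Avoids132 (l ++ m ∷ r)
avoids-++ {[]}    (split _ _ r<m) _ ar = No32Above-below r<m , ar
avoids-++ {x ∷ l} s@(split (x<m ∷ l<m) (r<x ∷ _) _) (pairs , al) ar =
  AllPairsₚ.++⁺ pairs (All.map (λ z<x (x<z , _) → <-asym x<z z<x) r<x ∷ No32Above-below r<x)
    (All.map (λ y<m → (λ (_ , m<y) → <-asym m<y y<m) ∷ All.map (λ z<x (x<z , _) → <-asym x<z z<x) r<x) l<m) ,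
  avoids-++ (Split-tail s) al ar

word-avoids : ∀ b t → Avoids132 (word b t)
word-avoids b leaf       = tt
word-avoids b (node l r) = avoids-++ (word-split b l r) (word-avoids _ l) (word-avoids b r)

-- Occurrences in a word cut at its maximum

<ᵇ-true : ∀ {m n} → m < n → (m <ᵇ n) ≡ true
<ᵇ-true {m} {n} = dec-true (m <? n)

<ᵇ-false : ∀ {m n} → n ≤ m → (m <ᵇ n) ≡ false
<ᵇ-false {m} {n} n≤m = dec-false (m <? n) (≤⇒≯ n≤m)

if-+ : ∀ c x y → (if c then x + y else 0) ≡ (if c then x else 0) + (if c then y else 0)
if-+ true  x y = refl
if-+ false x y = refl

increasing-below : ∀ k {a r} → All (_< a) r → increasing (suc k) a r ≡ 0
increasing-below k []          = refl
increasing-below k (z<a ∷ r<a) rewrite <ᵇ-false (<⇒≤ z<a) = increasing-below k r<a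

-- Every letter of `r` is too small to be used, so the subsequence stays in `l` or ends with `m`.
increasing-++ : ∀ k {a l m r} → a < m → All (_< a) r → Split l m r →
  increasing (suc k) a (l ++ m ∷ r) ≡ increasing (suc k) a l + increasing k a l
increasing-++ zero {l = []} a<m r<a s
  rewrite <ᵇ-true a<m | increasing-below 0 r<a = refl
increasing-++ (suc k) {l = []} a<m r<a s
  rewrite <ᵇ-true a<m | increasing-below k (r<m s) | increasing-below (suc k) r<a = refl
increasing-++ zero {a} {x ∷ l} a<m r<a s
  rewrite increasing-++ zero {a} a<m r<a (Split-tail s) = sym (+-assoc (if a <ᵇ x then 1 else 0) _ 1)
increasing-++ (suc k) {a} {x ∷ l} a<m r<a s@(split (x<m ∷ _) (r<x ∷ _) _)
  rewrite increasing-++ (suc k) {a} a<m r<a (Split-tail s) | increasing-++ k {x} x<m r<x (Split-tail s)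
        | if-+ (a <ᵇ x) (increasing (suc k) x l) (increasing k x l) =
  lemma (if a <ᵇ x then increasing (suc k) x l else 0) _ _ _
  where
  lemma : ∀ x y z w → x + y + (z + w) ≡ x + z + (y + w)
  lemma = solve-∀

occ12-∷ : ∀ k {m r} → All (_< m) r → occ12 k (m ∷ r) ≡ occ12 k r
occ12-∷ k []        = refl
occ12-∷ k (y<m ∷ _) rewrite <ᵇ-false (<⇒≤ y<m) = refl

-- These are ascents: `m` is followed by a descent, and it is preceded by an ascent when `l` is not
-- empty.
occ12-++-zero : ∀ {l m r} → Split l m r →
  occ12 0 (l ++ m ∷ r) ≡ occ12 0 l + occ12 0 r + sgn (length l)
occ12-++-zero {[]} s = trans (occ12-∷ 0 (r<m s)) (sym (+-identityʳ _))
occ12-++-zero {x ∷ []} {m} {r} s@(split (x<m ∷ _) _ r<m)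
  rewrite <ᵇ-true x<m | occ12-∷ 0 r<m = +-comm 1 (occ12 0 r)
occ12-++-zero {x ∷ l@(y ∷ _)} {m} {r} s rewrite occ12-++-zero (Split-tail s) =
  lemma (if x <ᵇ y then 1 else 0) (occ12 0 l) _ 1
  where
  lemma : ∀ x y z w → x + (y + z + w) ≡ x + y + z + w
  lemma = solve-∀

-- An ascent into `m` cannot be continued, since `m` exceeds all of `r`. An occurrence that starts
-- in `l` and uses `m` ends there, and removing `m` leaves an occurrence in `l` of the pattern
-- shorter by one.
occ12-++-suc : ∀ k {l m r} → Split l m r →
  occ12 (suc k) (l ++ m ∷ r) ≡ occ12 (suc k) l + occ12 (suc k) r + occ12 k l
occ12-++-suc k {[]} s = trans (occ12-∷ (suc k) (r<m s)) (sym (+-identityʳ _))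
occ12-++-suc k {x ∷ []} {m} {r} s@(split (x<m ∷ _) _ r<m)
  rewrite <ᵇ-true x<m | increasing-below k r<m | occ12-∷ (suc k) r<m = sym (+-identityʳ _)
occ12-++-suc k {x ∷ l@(y ∷ l′)} {m} {r} s@(split (_ ∷ y<m ∷ _) (_ ∷ r<y ∷ _) _)
  rewrite occ12-++-suc k (Split-tail s) | increasing-++ k {y} y<m r<y (Split-tail (Split-tail s))
        | if-+ (x <ᵇ y) (increasing (suc k) y l′) (increasing k y l′) =
  lemma (if x <ᵇ y then increasing (suc k) y l′ else 0) _ (occ12 (suc k) l) _ _
  where
  lemma : ∀ x y z w v → x + y + (z + w + v) ≡ x + z + w + (y + v)
  lemma = solve-∀

occ12-word : ∀ k b t → occ12 k (word b t) ≡ occᵗ k t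
occ12-word k       b leaf       = refl
occ12-word zero    b (node l r)
  rewrite occ12-++-zero (word-split b l r) | occ12-word 0 (size r + b) l | occ12-word 0 b r
        | length-word (size r + b) l = refl
occ12-word (suc k) b (node l r)
  rewrite occ12-++-suc k (word-split b l r) | occ12-word (suc k) (size r + b) l | occ12-word (suc k) b r
        | occ12-word k (size r + b) l = refl

-- Trees correspond bijectively to avoiding words

-- The left parts do not contain `m`, so the cut is at its first appearance.
++-∷-injective : ∀ {l l′ r r′ : List ℕ} {m} → All (_< m) l → All (_< m) l′ →
                 l ++ m ∷ r ≡ l′ ++ m ∷ r′ → l ≡ l′ × r ≡ r′
++-∷-injective []        []          refl = refl , refl
++-∷-injective []        (m<m ∷ _)   refl = contradiction m<m (<-irrefl refl)
++-∷-injective (m<m ∷ _) []          refl = contradiction m<m (<-irrefl refl)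
++-∷-injective (_ ∷ l<m) (_ ∷ l′<m) eq with x≡x′ , eq′ ← ∷-injective eq
  with refl , r≡r′ ← ++-∷-injective l<m l′<m eq′ = cong (_∷ _) x≡x′ , r≡r′

-- Equal words have equal lengths, so the trees have equal sizes and the words the same maximum;
-- cutting there separates the subtrees.
word-injective : ∀ b t t′ → word b t ≡ word b t′ → t ≡ t′
word-injective b leaf leaf _ = refl
word-injective b leaf t′@(node _ _) eq with () ← trans (cong length eq) (length-word b t′)
word-injective b t@(node _ _) leaf eq with () ← trans (sym (length-word b t)) (cong length eq)
word-injective b t@(node l r) t′@(node l′ r′) eq = cong₂ node l≡l′ r≡r′
  where
  size≡ : size t ≡ size t′
  size≡ = trans (sym (length-word b t)) (trans (cong length eq) (length-word b t′))
  top≡ : size l′ + (size r′ + b) ≡ size l + (size r + b)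
  top≡ = trans (sym (+-assoc (size l′) (size r′) b))
    (trans (cong (_+ b) (suc-injective (sym size≡))) (+-assoc (size l) (size r) b))
  parts : word (size r + b) l ≡ word (size r′ + b) l′ × word b r ≡ word b r′
  parts = ++-∷-injective (l<m (word-split b l r))
    (subst (λ m → All (_< m) (word (size r′ + b) l′)) top≡ (l<m (word-split b l′ r′)))
    (trans eq (cong (λ m → word (size r′ + b) l′ ++ m ∷ word b r′) top≡))
  r≡r′ : r ≡ r′
  r≡r′ = word-injective b r r′ (proj₂ parts)
  -- The offset of the left word contains the size of the right subtree, so `r≡r′` has to come
  -- first.
  l≡l′ : l ≡ l′
  l≡l′ = word-injective (size r + b) l l′ (trans (proj₁ parts) (cong (λ r → word (size r + b) l′) (sym r≡r′)))

AllPairs-++⁻ : ∀ {A : Set} {R : A → A → Set} l {m r} → AllPairs R (l ++ m ∷ r) →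
  AllPairs R l × AllPairs R r × All (λ x → R x m × All (R x) r) l × All (R m) r
AllPairs-++⁻ []      (mr ∷ rr) = [] , rr , [] , mr
AllPairs-++⁻ (x ∷ l) (xs ∷ ps) with xl , xm ∷ xr ← Allₚ.++⁻ l xs | ll , rr , lr , mr ← AllPairs-++⁻ l ps =
  xl ∷ ll , rr , (xm , xr) ∷ lr , mr

avoids-++⁻ : ∀ l {m r} → Avoids132 (l ++ m ∷ r) →
  Avoids132 l × Avoids132 r × All (λ x → All (No32Above x m) r) l
avoids-++⁻ []      (_ , ar)  = tt , ar , []
avoids-++⁻ (x ∷ l) (ps , av) with xl , _ , _ , mr ← AllPairs-++⁻ l ps | al , ar , lr ← avoids-++⁻ l av =
  (xl , al) , ar , mr ∷ lr

AllPairs-lookup : ∀ {A : Set} {R : A → A → Set} {w : List A} → AllPairs R w →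
                  ∀ i j → i Fin.< j → R (List.lookup w i) (List.lookup w j)
AllPairs-lookup {w = w} ps i j i<j =
  AllPairs-tabulate⁻ (List.lookup w) (subst (AllPairs _) (sym (tabulate-lookup w)) ps) i j i<j

unique-lookup-injective : ∀ {w : List ℕ} → Unique w → ∀ {i j} → List.lookup w i ≡ List.lookup w j → i ≡ j
unique-lookup-injective u {i} {j} eq with Finₚ.<-cmp i j
... | tri< i<j _ _ = contradiction eq (AllPairs-lookup u i j i<j)
... | tri≈ _ i≡j _ = i≡j
... | tri> _ _ j<i = contradiction (sym eq) (AllPairs-lookup u j i j<i)

-- Pigeonhole: subtracting `a` from the letters sends the positions injectively into `Fin (c ∸ a)`.
unique-within-length : ∀ {a c w} → Unique w → Within a c w → length w ≤ c ∸ a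
unique-within-length {a} {c} {w} u within = Finₚ.injective⇒≤ {f = shift} shift-injective
  where
  bounds : ∀ i → a ≤ List.lookup w i × List.lookup w i < c
  bounds i = All.lookup within (∈-lookup i)
  shift : Fin (length w) → Fin (c ∸ a)
  shift i = fromℕ< (∸-monoˡ-< (proj₂ (bounds i)) (proj₁ (bounds i)))
  shift-injective : ∀ {i j} → shift i ≡ shift j → i ≡ j
  shift-injective {i} {j} eq = unique-lookup-injective u
    (∸-cancelʳ-≡ (proj₁ (bounds i)) (proj₁ (bounds j)) (Finₚ.fromℕ<-injective _ _ _ _ eq))

-- Otherwise `suc n` distinct letters would lie in an interval of `n` values.
max∈ : ∀ n {b w} → length w ≡ suc n → Unique w → Within b (suc n + b) w → n + b ∈ w
max∈ n {b} {w} len u within with _[_]∈?_ _≟_ (n + b) w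
... | yes p = p
... | no ∉w = contradiction
  (subst₂ _≤_ len (m+n∸n≡m n b) (unique-within-length u (All.tabulate λ {x} x∈w →
    let b≤x , x<top = All.lookup within x∈w
    in b≤x , ≤∧≢⇒< (s≤s⁻¹ x<top) λ { refl → ∉w x∈w })))
  (<-irrefl refl)

-- Sizes and words are free variables here, so that every equation can be matched with `refl` in
-- place of transports.
node-word : ∀ b t u {s l m r} → size u ≡ s → word (s + b) t ≡ l → word b u ≡ r → size t + (s + b) ≡ m →
            word b (node t u) ≡ l ++ m ∷ r
node-word b t u refl refl refl refl = refl

-- The word is cut at its maximum and both parts are treated recursively; the fuel `f` serves
-- because they are not structural subterms. Avoidance puts `r` below `l`, and counting letters then
-- shows that each part fills an interval.
word-surjective : ∀ f {n} b w → n ≤ f → length w ≡ n → Unique w → Within b (n + b) w → Avoids132 w →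
                  ∃[ t ] word b t ≡ w
word-surjective f       {zero}  b []  _         _   _ _      _  = leaf , refl
word-surjective (suc f) {suc n} b w   (s≤s n≤f) len u within av
  with l , r , refl ← ∈-∃++ (max∈ n len u within)
  with ul , ur , u-lr , u-mr ← AllPairs-++⁻ l u
     | al , ar , a-lr ← avoids-++⁻ l av
     | wl , (_ ∷ wr) ← Allₚ.++⁻ l within =
  let t , eqt = word-surjective f (length r + b) l (≤-trans (m+n≤o⇒m≤o (length l) (≤-reflexive l+r≡n)) n≤f) refl ul l-within al
      v , eqv = word-surjective f b r (≤-trans (m+n≤o⇒n≤o (length l) (≤-reflexive l+r≡n)) n≤f) refl ur r-within ar
      size-t = trans (sym (length-word _ t)) (cong length eqt)
      size-v = trans (sym (length-word b v)) (cong length eqv)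
  in node t v , node-word b t v size-v eqt eqv (trans (cong (_+ (length r + b)) size-t) (sym top≡))
  where
  l+r≡n : length l + length r ≡ n
  l+r≡n = suc-injective (trans (sym (+-suc (length l) (length r))) (trans (sym (length-++ l)) len))
  top≡ : n + b ≡ length l + (length r + b)
  top≡ = trans (cong (_+ b) (sym l+r≡n)) (+-assoc (length l) (length r) b)
  l<top : All (_< n + b) l
  l<top = All.zipWith (λ ((_ , x<) , (x≢ , _)) → ≤∧≢⇒< (s≤s⁻¹ x<) x≢) (wl , u-lr)
  r<top : All (_< n + b) r
  r<top = All.zipWith (λ ((_ , x<) , top≢x) → ≤∧≢⇒< (s≤s⁻¹ x<) (top≢x ∘ sym)) (wr , u-mr)
  r-below-l : All (λ x → All (_< x) r) l
  -- If `x < z`, then `x`, the maximum and `z` would form a 1-3-2; distinctness excludes equality.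
  r-below-l = All.zipWith (λ (avx , (_ , ux)) →
    All.zipWith (λ ((z<top , avz) , x≢z) → ≤∧≢⇒< (≮⇒≥ (λ x<z → avz (x<z , z<top))) (x≢z ∘ sym))
                (All.zip (r<top , avx) , ux)) (a-lr , u-lr)
  r-within : Within b (length r + b) r
  -- All letters of `l` lie strictly between `z` and the maximum; their number bounds `z` from
  -- above.
  r-within = All.tabulate λ {z} z∈r → proj₁ (All.lookup wr z∈r) ,
    +-cancelˡ-≤ (length l) _ _ (≤-trans
      (+-monoˡ-≤ (suc z) (unique-within-length ul
        (All.zipWith (λ (x<top , z<x) → All.lookup z<x z∈r , x<top) (l<top , r-below-l))))
      (≤-reflexive (trans (m∸n+n≡m (All.lookup r<top z∈r)) top≡)))
  l-within : Within (length r + b) (length l + (length r + b)) l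
  -- Dually, all letters of `r` lie in the interval from `b` up to but excluding `x`, which bounds
  -- `x` from below.
  l-within = All.tabulate λ {x} x∈l →
    (≤-trans (+-monoˡ-≤ b (unique-within-length ur (All.zipWith (λ ((b≤z , _) , z<x) → b≤z , z<x) (wr , All.lookup r-below-l x∈l))))
             (≤-reflexive (m∸n+n≡m (proj₁ (All.lookup wl x∈l))))) ,
    subst (x <_) top≡ (All.lookup l<top x∈l)

-- The fuel bounds the size, so `trees f n` lists the trees of size n when n ≤ f.

trees : ℕ → ℕ → List Tree
nodes : ℕ → ℕ → ℕ → List Tree

trees f       zero    = leaf ∷ []
trees zero    (suc n) = []
trees (suc f) (suc n) = concat (tabulate {n = suc n} (nodes f n ∘ toℕ))

nodes f n j = cartesianProductWith node (trees f j) (trees f (n ∸ j))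

∈-nodes⁻ : ∀ f n j {t} → t ∈ nodes f n j → ∃[ l ] ∃[ r ] l ∈ trees f j × r ∈ trees f (n ∸ j) × t ≡ node l r
∈-nodes⁻ f n j = ∈-cartesianProductWith⁻ node (trees f j) (trees f (n ∸ j))

∈-trees⁻ : ∀ f n {t} → t ∈ trees f n → size t ≡ n
∈-trees⁻ f       zero    (here refl) = refl
∈-trees⁻ (suc f) (suc n) t∈
  with ts , t∈ts , ts∈ ← ∈-concat⁻′ (tabulate {n = suc n} (nodes f n ∘ toℕ)) t∈
  with j , refl ← ∈-tabulate⁻ {n = suc n} {f = nodes f n ∘ toℕ} ts∈
  with l , r , l∈ , r∈ , refl ← ∈-nodes⁻ f n (toℕ j) t∈ts =
  cong suc (trans (cong₂ _+_ (∈-trees⁻ f (toℕ j) l∈) (∈-trees⁻ f (n ∸ toℕ j) r∈)) (m+[n∸m]≡n (Finₚ.toℕ≤pred[n] j)))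

∈-trees⁺ : ∀ f t → size t ≤ f → t ∈ trees f (size t)
∈-trees⁺ f       leaf       _         = here refl
∈-trees⁺ (suc f) (node l r) (s≤s s≤f) = ∈-concat⁺′ node∈
  (∈-tabulate⁺ {n = suc (size l + size r)} {f = nodes f (size l + size r) ∘ toℕ} j)
  where
  j : Fin (suc (size l + size r))
  j = fromℕ< (s≤s (m≤m+n (size l) (size r)))
  node∈ : node l r ∈ nodes f (size l + size r) (toℕ j)
  node∈ rewrite Finₚ.toℕ-fromℕ< (s≤s (m≤m+n (size l) (size r))) | m+n∸m≡n (size l) (size r) =
    ∈-cartesianProductWith⁺ node (∈-trees⁺ f l (m+n≤o⇒m≤o (size l) s≤f)) (∈-trees⁺ f r (m+n≤o⇒n≤o (size l) s≤f))

node-injective : ∀ {l l′ r r′} → node l r ≡ node l′ r′ → l ≡ l′ × r ≡ r′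
node-injective refl = refl , refl

trees-unique : ∀ f n → Unique (trees f n)
trees-unique f       zero    = [] ∷ []
trees-unique zero    (suc n) = []
trees-unique (suc f) (suc n) = Uniqueₚ.concat⁺
  (Allₚ.tabulate⁺ {n = suc n} {f = nodes f n ∘ toℕ} λ j →
    Uniqueₚ.cartesianProductWith⁺ node node-injective (trees-unique f (toℕ j)) (trees-unique f (n ∸ toℕ j)))
  -- Lists for different `j` are disjoint, because `j` is the size of the left subtree.
  (AllPairsₚ.tabulate⁺ {n = suc n} {f = nodes f n ∘ toℕ} λ {i} {j} i≢j (t∈i , t∈j) →
    i≢j (Finₚ.toℕ-injective (same-index (toℕ i) (toℕ j) t∈i t∈j)))
  where
  same-index : ∀ i j {t} → t ∈ nodes f n i → t ∈ nodes f n j → i ≡ j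
  same-index i j t∈i t∈j
    with l , _ , l∈i , _ , refl ← ∈-nodes⁻ f n i t∈i
    with _ , _ , l∈j , _ , refl ← ∈-nodes⁻ f n j t∈j =
    trans (sym (∈-trees⁻ f i l∈i)) (∈-trees⁻ f j l∈j)

-- Counting avoiding permutations by trees

-- The images in `C` are duplicate-free lists with the same elements, hence rearrangements of each
-- other. Permutations and trees are compared in this way through their words.
length-≡-by-images : ∀ {A B C : Set} {xs : List A} {ys : List B} (g : A → C) (h : B → C) →
  (∀ {x y} → g x ≡ g y → x ≡ y) → (∀ {x y} → h x ≡ h y → x ≡ y) → Unique xs → Unique ys →
  (∀ {x} → x ∈ xs → ∃[ y ] y ∈ ys × g x ≡ h y) →
  (∀ {y} → y ∈ ys → ∃[ x ] x ∈ xs × h y ≡ g x) →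
  length xs ≡ length ys
length-≡-by-images {xs = xs} {ys} g h g-inj h-inj uxs uys to from = begin
  length xs              ≡⟨ length-map g xs ⟨
  length (List.map g xs) ≡⟨ ↭-length (∼bag⇒↭ (unique∧set⇒bag (Uniqueₚ.map⁺ g-inj uxs) (Uniqueₚ.map⁺ h-inj uys)
                              (mk⇔ (sends to) (sends from)))) ⟩
  length (List.map h ys) ≡⟨ length-map h ys ⟩
  length ys ∎
  where
  open ≡-Reasoning
  sends : ∀ {A B C : Set} {xs : List A} {ys : List B} {g : A → C} {h : B → C} →
    (∀ {x} → x ∈ xs → ∃[ y ] y ∈ ys × g x ≡ h y) → ∀ {c} → c ∈ List.map g xs → c ∈ List.map h ys
  sends {ys = ys} {g = g} {h} f c∈ with x , x∈ , refl ← ∈-map⁻ g c∈ with y , y∈ , eq ← f x∈ =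
    subst (_∈ List.map h ys) (sym eq) (∈-map⁺ h y∈)

words-unique : ∀ n k → Unique (words n k)
words-unique n zero    = [] ∷ []
words-unique n (suc k) = Uniqueₚ.cartesianProductWith⁺ _∷_ Vecₚ.∷-injective (Uniqueₚ.allFin⁺ n) (words-unique n k)

values-injective : ∀ {n} {π ρ : Vec (Fin n) n} → values π ≡ values ρ → π ≡ ρ
values-injective {n} {π} {ρ} eq = begin
  π                        ≡⟨ Vecₚ.tabulate∘lookup π ⟨
  Vec.tabulate (lookup π)  ≡⟨ Vecₚ.tabulate-cong (λ i → Finₚ.toℕ-injective (tabulate-injective eq i)) ⟩
  Vec.tabulate (lookup ρ)  ≡⟨ Vecₚ.tabulate∘lookup ρ ⟩
  ρ ∎
  where
  open ≡-Reasoning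
  tabulate-injective : ∀ {n} {g h : Fin n → ℕ} → tabulate g ≡ tabulate h → ∀ i → g i ≡ h i
  tabulate-injective eq zero    = proj₁ (∷-injective eq)
  tabulate-injective eq (suc i) = tabulate-injective (proj₂ (∷-injective eq)) i

values-surjective : ∀ {n} w → length w ≡ n → Unique w → Within 0 n w →
  ∃[ π ] VecUnique.Unique {n = n} π × values π ≡ w
values-surjective w refl u within = Vec.tabulate g , VecUniqueₚ.tabulate⁺ g-injective ,
  trans (tabulate-cong λ i → trans (cong toℕ (Vecₚ.lookup∘tabulate g i)) (Finₚ.toℕ-fromℕ< _)) (tabulate-lookup w)
  where
  g : Fin (length w) → Fin (length w)
  g i = fromℕ< (proj₂ (All.lookup within (∈-lookup i)))
  g-injective : ∀ {i j} → g i ≡ g j → i ≡ j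
  g-injective eq = unique-lookup-injective u (Finₚ.fromℕ<-injective _ _ _ _ eq)

permutation⇒tree : ∀ {n} (π : Vec (Fin n) n) → VecUnique.Unique π → Avoids132 (values π) →
                   ∃[ t ] size t ≡ n × word 0 t ≡ values π
permutation⇒tree {n} π uπ av = proj₁ tree , trans (sym (length-word 0 (proj₁ tree))) (trans (cong length (proj₂ tree)) length≡n) , proj₂ tree
  where
  length≡n : length (values π) ≡ n
  length≡n = length-tabulate (toℕ ∘ lookup π)
  tree : ∃[ t ] word 0 t ≡ values π
  tree = word-surjective n 0 (values π) ≤-refl length≡n
    (Uniqueₚ.tabulate⁺ λ {i} {j} eq → VecUniqueₚ.lookup-injective uπ i j (Finₚ.toℕ-injective eq))
    (Allₚ.tabulate⁺ λ i → z≤n , subst (toℕ (lookup π i) <_) (sym (+-identityʳ n)) (Finₚ.toℕ<n (lookup π i)))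
    av

tree⇒permutation : ∀ {n} t → size t ≡ n → ∃[ π ] VecUnique.Unique {n = n} π × values π ≡ word 0 t
tree⇒permutation {n} t size≡n = values-surjective (word 0 t) (trans (length-word 0 t) size≡n) (word-unique 0 t)
  (Within-⊆ z≤n (≤-reflexive (trans (+-identityʳ (size t)) size≡n)) (word-within 0 t))

f≡trees : ∀ k n r {fuel} → n ≤ fuel →
  f (pattern12-3-⋯- (2 + k)) r n ≡ length (filter (λ t → occᵗ k t ≟ r) (trees fuel n))
f≡trees k n r {fuel} n≤fuel = length-≡-by-images values (word 0) values-injective (λ {t} {u} → word-injective 0 t u)
  (Uniqueₚ.filter⁺ P? (Uniqueₚ.filter⁺ unique? (words-unique n n)))
  (Uniqueₚ.filter⁺ Q? (trees-unique fuel n)) to from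
  where
  P : Vec (Fin n) n → Set
  P π = occurrences pattern1-3-2 π ≡ 0 × occurrences (pattern12-3-⋯- (2 + k)) π ≡ r
  P? : Decidable P
  P? π = (occurrences pattern1-3-2 π ≟ 0) ×-dec (occurrences (pattern12-3-⋯- (2 + k)) π ≟ r)
  Q? : Decidable λ t → occᵗ k t ≡ r
  Q? t = occᵗ k t ≟ r
  occ≡ : ∀ {π t} → word 0 t ≡ values π → occurrences (pattern12-3-⋯- (2 + k)) π ≡ occᵗ k t
  occ≡ {π} {t} eq = trans (occurrences≡occ12 π k) (trans (cong (occ12 k) (sym eq)) (occ12-word k 0 t))
  to : ∀ {π} → π ∈ filter P? (S n) → ∃[ t ] t ∈ filter Q? (trees fuel n) × values π ≡ word 0 t
  to {π} π∈ =
    let π∈S , none , occ≡r = ∈-filter⁻ P? {xs = S n} π∈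
        t , size≡ , eq = permutation⇒tree π (proj₂ (∈-filter⁻ unique? {xs = words n n} π∈S)) (occurrences132≡0⇒avoids π none)
    in t , ∈-filter⁺ Q? (subst (λ m → t ∈ trees fuel m) size≡ (∈-trees⁺ fuel t (≤-trans (≤-reflexive size≡) n≤fuel)))
             (trans (sym (occ≡ {π} {t} eq)) occ≡r) ,
       sym eq
  from : ∀ {t} → t ∈ filter Q? (trees fuel n) → ∃[ π ] π ∈ filter P? (S n) × word 0 t ≡ values π
  from {t} t∈ =
    let t∈trees , occ≡r = ∈-filter⁻ Q? {xs = trees fuel n} t∈
        π , uπ , eq = tree⇒permutation t (∈-trees⁻ fuel n t∈trees)
    in π , ∈-filter⁺ P? (∈-filter⁺ unique? (∈-words π) uπ)
             (avoids⇒occurrences132≡0 π (subst Avoids132 (sym eq) (word-avoids 0 t)) ,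
              trans (occ≡ {π} {t} (sym eq)) occ≡r) ,
       sym eq

-- Generating functions

open RawRing ℤ[y] using (1#) renaming (_+_ to infixl 6 _⊕_; _*_ to infixl 7 _⊗_; -_ to infix 8 ⊖_)
open PowerSeries ℤ[y] using (recipUpTo) renaming (sum to sumₚ)

-- Polynomial arithmetic by coefficients

coeff-⊕ : ∀ p q r → coeff (p ⊕ q) r ≡ coeff p r ℤ.+ coeff q r
coeff-⊕ []      q       r       = sym (ℤₚ.+-identityˡ _)
coeff-⊕ (c ∷ p) []      r       = sym (ℤₚ.+-identityʳ _)
coeff-⊕ (c ∷ p) (d ∷ q) zero    = refl
coeff-⊕ (c ∷ p) (d ∷ q) (suc r) = coeff-⊕ p q r

coeff-⊖ : ∀ p r → coeff (⊖ p) r ≡ ℤ.- coeff p r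
coeff-⊖ []      r       = refl
coeff-⊖ (c ∷ p) zero    = refl
coeff-⊖ (c ∷ p) (suc r) = coeff-⊖ p r

coeff-scale : ∀ c p r → coeff (List.map (c ℤ.*_) p) r ≡ c ℤ.* coeff p r
coeff-scale c []      r       = sym (ℤₚ.*-zeroʳ c)
coeff-scale c (d ∷ p) zero    = refl
coeff-scale c (d ∷ p) (suc r) = coeff-scale c p r

-- The Cauchy product of coefficient functions. The laws are proved here, where trailing zeros of
-- lists play no part.
conv : (ℕ → ℤ) → (ℕ → ℤ) → ℕ → ℤ
conv a b zero    = a 0 ℤ.* b 0
conv a b (suc r) = a 0 ℤ.* b (suc r) ℤ.+ conv (a ∘ suc) b r

conv-cong : ∀ {a a′ b b′} → (∀ r → a r ≡ a′ r) → (∀ r → b r ≡ b′ r) → ∀ r → conv a b r ≡ conv a′ b′ r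
conv-cong a≡ b≡ zero    = cong₂ ℤ._*_ (a≡ 0) (b≡ 0)
conv-cong a≡ b≡ (suc r) = cong₂ ℤ._+_ (cong₂ ℤ._*_ (a≡ 0) (b≡ (suc r))) (conv-cong (a≡ ∘ suc) b≡ r)

conv-zeroˡ : ∀ b r → conv (λ _ → 0ℤ) b r ≡ 0ℤ
conv-zeroˡ b zero    = refl
conv-zeroˡ b (suc r) = trans (ℤₚ.+-identityˡ _) (conv-zeroˡ b r)

conv-distribˡ : ∀ a b c r → conv a (λ r → b r ℤ.+ c r) r ≡ conv a b r ℤ.+ conv a c r
conv-distribˡ a b c zero    = ℤₚ.*-distribˡ-+ (a 0) (b 0) (c 0)
conv-distribˡ a b c (suc r) rewrite conv-distribˡ (a ∘ suc) b c r = lemma (a 0) (b (suc r)) (c (suc r)) _ _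
  where
  lemma : ∀ a b c x y → a ℤ.* (b ℤ.+ c) ℤ.+ (x ℤ.+ y) ≡ a ℤ.* b ℤ.+ x ℤ.+ (a ℤ.* c ℤ.+ y)
  lemma = solve-∀ℤ

conv-distribʳ : ∀ a b c r → conv (λ r → a r ℤ.+ b r) c r ≡ conv a c r ℤ.+ conv b c r
conv-distribʳ a b c zero    = ℤₚ.*-distribʳ-+ (c 0) (a 0) (b 0)
conv-distribʳ a b c (suc r) rewrite conv-distribʳ (a ∘ suc) (b ∘ suc) c r = lemma (a 0) (b 0) (c (suc r)) _ _
  where
  lemma : ∀ a b c x y → (a ℤ.+ b) ℤ.* c ℤ.+ (x ℤ.+ y) ≡ a ℤ.* c ℤ.+ x ℤ.+ (b ℤ.* c ℤ.+ y)
  lemma = solve-∀ℤ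

conv-negˡ : ∀ a b r → conv (λ r → ℤ.- a r) b r ≡ ℤ.- conv a b r
conv-negˡ a b zero    = sym (ℤₚ.neg-distribˡ-* (a 0) (b 0))
conv-negˡ a b (suc r) rewrite conv-negˡ (a ∘ suc) b r = lemma (a 0) (b (suc r)) _
  where
  lemma : ∀ a b x → (ℤ.- a) ℤ.* b ℤ.+ ℤ.- x ≡ ℤ.- (a ℤ.* b ℤ.+ x)
  lemma = solve-∀ℤ

coeff-⊗ : ∀ p q r → coeff (p ⊗ q) r ≡ conv (coeff p) (coeff q) r
coeff-⊗ []      q r       = sym (conv-zeroˡ (coeff q) r)
coeff-⊗ (c ∷ p) q zero    = trans (coeff-⊕ (List.map (c ℤ.*_) q) _ 0) (trans (ℤₚ.+-identityʳ _) (coeff-scale c q 0))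
coeff-⊗ (c ∷ p) q (suc r) = trans (coeff-⊕ (List.map (c ℤ.*_) q) _ (suc r)) (cong₂ ℤ._+_ (coeff-scale c q (suc r)) (coeff-⊗ p q r))

-- A record, unlike the function type it wraps, lets Agda recover the two polynomials.

record _≋_ (p q : Poly) : Set where
  constructor coeffs
  field
    at : ∀ r → coeff p r ≡ coeff q r
open _≋_

infix 4 _≋_

≋-setoid : Setoid 0ℓ 0ℓ
≋-setoid = record
  { Carrier = Poly
  ; _≈_ = _≋_
  ; isEquivalence = record
    { refl  = coeffs λ _ → refl
    ; sym   = λ p≋q → coeffs (sym ∘ at p≋q)
    ; trans = λ p≋q q≋s → coeffs λ r → trans (at p≋q r) (at q≋s r)
    }
  }

open Setoid ≋-setoid using () renaming (refl to ≋-refl; sym to ≋-sym; trans to ≋-trans; reflexive to ≋-reflexive)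
module ≋-Reasoning = Relation.Binary.Reasoning.Setoid ≋-setoid

⊕-cong : ∀ {p p′ q q′} → p ≋ p′ → q ≋ q′ → p ⊕ q ≋ p′ ⊕ q′
⊕-cong {p} {p′} {q} {q′} p≋ q≋ = coeffs λ r →
  trans (coeff-⊕ p q r) (trans (cong₂ ℤ._+_ (at p≋ r) (at q≋ r)) (sym (coeff-⊕ p′ q′ r)))

⊖-cong : ∀ {p q} → p ≋ q → ⊖ p ≋ ⊖ q
⊖-cong {p} {q} p≋q = coeffs λ r → trans (coeff-⊖ p r) (trans (cong ℤ.-_ (at p≋q r)) (sym (coeff-⊖ q r)))

⊗-cong : ∀ {p p′ q q′} → p ≋ p′ → q ≋ q′ → p ⊗ q ≋ p′ ⊗ q′
⊗-cong {p} {p′} {q} {q′} p≋ q≋ = coeffs λ r →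
  trans (coeff-⊗ p q r) (trans (conv-cong (at p≋) (at q≋) r) (sym (coeff-⊗ p′ q′ r)))

⊕-identityʳ : ∀ p → p ⊕ [] ≋ p
⊕-identityʳ p = coeffs λ r → trans (coeff-⊕ p [] r) (ℤₚ.+-identityʳ _)

⊕-assoc : ∀ p q s → (p ⊕ q) ⊕ s ≋ p ⊕ (q ⊕ s)
⊕-assoc p q s = coeffs lemma
  where
  lemma : ∀ r → coeff ((p ⊕ q) ⊕ s) r ≡ coeff (p ⊕ (q ⊕ s)) r
  lemma r rewrite coeff-⊕ (p ⊕ q) s r | coeff-⊕ p q r | coeff-⊕ p (q ⊕ s) r | coeff-⊕ q s r =
    ℤₚ.+-assoc (coeff p r) _ _

⊕-inverseʳ : ∀ p → p ⊕ ⊖ p ≋ []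
⊕-inverseʳ p = coeffs λ r →
  trans (coeff-⊕ p (⊖ p) r) (trans (cong (λ c → coeff p r ℤ.+ c) (coeff-⊖ p r)) (ℤₚ.+-inverseʳ (coeff p r)))

⊖-⊕ : ∀ p q → ⊖ (p ⊕ q) ≋ ⊖ p ⊕ ⊖ q
⊖-⊕ p q = coeffs lemma
  where
  lemma : ∀ r → coeff (⊖ (p ⊕ q)) r ≡ coeff (⊖ p ⊕ ⊖ q) r
  lemma r rewrite coeff-⊖ (p ⊕ q) r | coeff-⊕ (⊖ p) (⊖ q) r | coeff-⊕ p q r | coeff-⊖ p r | coeff-⊖ q r =
    ℤₚ.neg-distrib-+ (coeff p r) _

-- One sign comes from the recursion of `recip`, the other from the coefficients of the denominator.
⊖-⊖⊗ : ∀ p q → ⊖ (⊖ p ⊗ q) ≋ p ⊗ q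
⊖-⊖⊗ p q = coeffs λ r → begin
  coeff (⊖ (⊖ p ⊗ q)) r                            ≡⟨ coeff-⊖ (⊖ p ⊗ q) r ⟩
  ℤ.- coeff (⊖ p ⊗ q) r                            ≡⟨ cong ℤ.-_ (coeff-⊗ (⊖ p) q r) ⟩
  ℤ.- conv (coeff (⊖ p)) (coeff q) r               ≡⟨ cong ℤ.-_ (conv-cong (coeff-⊖ p) (λ _ → refl) r) ⟩
  ℤ.- conv (λ r → ℤ.- coeff p r) (coeff q) r       ≡⟨ cong ℤ.-_ (conv-negˡ (coeff p) (coeff q) r) ⟩
  ℤ.- (ℤ.- conv (coeff p) (coeff q) r)             ≡⟨ ℤₚ.neg-involutive _ ⟩
  conv (coeff p) (coeff q) r                       ≡⟨ coeff-⊗ p q r ⟨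
  coeff (p ⊗ q) r ∎
  where open ≡-Reasoning

⊗-distribˡ : ∀ p q s → p ⊗ (q ⊕ s) ≋ p ⊗ q ⊕ p ⊗ s
⊗-distribˡ p q s = coeffs λ r → begin
  coeff (p ⊗ (q ⊕ s)) r                                               ≡⟨ coeff-⊗ p (q ⊕ s) r ⟩
  conv (coeff p) (coeff (q ⊕ s)) r                                    ≡⟨ conv-cong (λ _ → refl) (coeff-⊕ q s) r ⟩
  conv (coeff p) (λ r → coeff q r ℤ.+ coeff s r) r                    ≡⟨ conv-distribˡ (coeff p) (coeff q) (coeff s) r ⟩
  conv (coeff p) (coeff q) r ℤ.+ conv (coeff p) (coeff s) r           ≡⟨ cong₂ ℤ._+_ (coeff-⊗ p q r) (coeff-⊗ p s r) ⟨
  coeff (p ⊗ q) r ℤ.+ coeff (p ⊗ s) r                                 ≡⟨ coeff-⊕ (p ⊗ q) (p ⊗ s) r ⟨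
  coeff (p ⊗ q ⊕ p ⊗ s) r ∎
  where open ≡-Reasoning

⊗-distribʳ : ∀ p q s → (p ⊕ q) ⊗ s ≋ p ⊗ s ⊕ q ⊗ s
⊗-distribʳ p q s = coeffs λ r → begin
  coeff ((p ⊕ q) ⊗ s) r                                               ≡⟨ coeff-⊗ (p ⊕ q) s r ⟩
  conv (coeff (p ⊕ q)) (coeff s) r                                    ≡⟨ conv-cong (coeff-⊕ p q) (λ _ → refl) r ⟩
  conv (λ r → coeff p r ℤ.+ coeff q r) (coeff s) r                    ≡⟨ conv-distribʳ (coeff p) (coeff q) (coeff s) r ⟩
  conv (coeff p) (coeff s) r ℤ.+ conv (coeff q) (coeff s) r           ≡⟨ cong₂ ℤ._+_ (coeff-⊗ p s r) (coeff-⊗ q s r) ⟨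
  coeff (p ⊗ s) r ℤ.+ coeff (q ⊗ s) r                                 ≡⟨ coeff-⊕ (p ⊗ s) (q ⊗ s) r ⟨
  coeff (p ⊗ s ⊕ q ⊗ s) r ∎
  where open ≡-Reasoning

⊗-zeroʳ : ∀ p → p ⊗ [] ≋ []
⊗-zeroʳ []      = ≋-refl
⊗-zeroʳ (c ∷ p) = coeffs λ { zero → refl ; (suc r) → at (⊗-zeroʳ p) r }

⊗-identityˡ : ∀ p → 1# ⊗ p ≋ p
⊗-identityˡ p = coeffs λ r → trans (coeff-⊗ 1# p r) (lemma r)
  where
  lemma : ∀ r → conv (coeff 1#) (coeff p) r ≡ coeff p r
  lemma zero    = ℤₚ.*-identityˡ _
  lemma (suc r) = trans (cong₂ ℤ._+_ (ℤₚ.*-identityˡ (coeff p (suc r))) (conv-zeroˡ (coeff p) r)) (ℤₚ.+-identityʳ _)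

⊗-identityʳ : ∀ p → p ⊗ 1# ≋ p
⊗-identityʳ []      = ≋-refl
⊗-identityʳ (c ∷ p) = coeffs λ
  { zero    → trans (ℤₚ.+-identityʳ _) (ℤₚ.*-identityʳ c)
  ; (suc r) → at (⊗-identityʳ p) r }

y^-+ : ∀ a b → y^ (a + b) ≋ y^ a ⊗ y^ b
y^-+ zero    b = ≋-sym (⊗-identityˡ (y^ b))
y^-+ (suc a) b = coeffs λ r → trans (lemma r) (sym (coeff-⊗ (y^ (suc a)) (y^ b) r))
  where
  lemma : ∀ r → coeff (y^ (suc a + b)) r ≡ conv (coeff (y^ (suc a))) (coeff (y^ b)) r
  lemma zero    = refl
  lemma (suc r) = trans (at (y^-+ a b) r) (trans (coeff-⊗ (y^ a) (y^ b) r) (sym (ℤₚ.+-identityˡ _)))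

coeff-y^ : ∀ d r → coeff (y^ d) r ≡ (if d ≡ᵇ r then 1ℤ else 0ℤ)
coeff-y^ zero    zero    = refl
coeff-y^ zero    (suc r) = refl
coeff-y^ (suc d) zero    = refl
coeff-y^ (suc d) (suc r) = coeff-y^ d r

-- Sums of polynomials over lists

module _ {T : Set} where

  sum-map-++ : ∀ (h : T → Poly) ts us → sumₚ (List.map h (ts ++ us)) ≋ sumₚ (List.map h ts) ⊕ sumₚ (List.map h us)
  sum-map-++ h []       us = ≋-refl
  sum-map-++ h (t ∷ ts) us = ≋-trans (⊕-cong ≋-refl (sum-map-++ h ts us)) (≋-sym (⊕-assoc (h t) _ _))

  sum-concat-tabulate : ∀ (h : T → Poly) {n} (g : Fin n → List T) →
    sumₚ (List.map h (concat (tabulate g))) ≋ sumₚ (tabulate λ j → sumₚ (List.map h (g j)))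
  sum-concat-tabulate h {zero}  g = ≋-refl
  sum-concat-tabulate h {suc n} g =
    ≋-trans (sum-map-++ h (g zero) _) (⊕-cong ≋-refl (sum-concat-tabulate h (g ∘ suc)))

  sum-map-cong : ∀ {h k : T → Poly} {ts} → All (λ t → h t ≋ k t) ts → sumₚ (List.map h ts) ≋ sumₚ (List.map k ts)
  sum-map-cong []       = ≋-refl
  sum-map-cong (e ∷ es) = ⊕-cong e (sum-map-cong es)

  sum-⊗ˡ : ∀ p (h : T → Poly) ts → sumₚ (List.map (λ t → p ⊗ h t) ts) ≋ p ⊗ sumₚ (List.map h ts)
  sum-⊗ˡ p h []       = ≋-sym (⊗-zeroʳ p)
  sum-⊗ˡ p h (t ∷ ts) = ≋-trans (⊕-cong ≋-refl (sum-⊗ˡ p h ts)) (≋-sym (⊗-distribˡ p (h t) _))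

  coeff-sum-y^ : ∀ (w : T → ℕ) ts r →
    coeff (sumₚ (List.map (y^ ∘ w) ts)) r ≡ ℤ.+ length (filter (λ t → w t ≟ r) ts)
  coeff-sum-y^ w []       r = refl
  coeff-sum-y^ w (t ∷ ts) r
    rewrite coeff-⊕ (y^ (w t)) (sumₚ (List.map (y^ ∘ w) ts)) r | coeff-sum-y^ w ts r | coeff-y^ (w t) r
    with w t ≡ᵇ r
  ... | true  = refl
  ... | false = refl

-- The product rule for generating functions: expanding the product of the sums gives one term for
-- each pair.
sum-cartesianProductWith : ∀ {T U V : Set} (c : T → U → V) {h : V → Poly} {u : T → Poly} {v : U → Poly} →
  (∀ t s → h (c t s) ≋ u t ⊗ v s) → ∀ ts ss →
  sumₚ (List.map h (cartesianProductWith c ts ss)) ≋ sumₚ (List.map u ts) ⊗ sumₚ (List.map v ss)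
sum-cartesianProductWith c         hc≋ []       ss = ≋-refl
sum-cartesianProductWith c {h} {u} {v} hc≋ (t ∷ ts) ss = begin
  sumₚ (List.map h (List.map (c t) ss ++ cartesianProductWith c ts ss))
    ≈⟨ sum-map-++ h (List.map (c t) ss) _ ⟩
  sumₚ (List.map h (List.map (c t) ss)) ⊕ sumₚ (List.map h (cartesianProductWith c ts ss))
    ≈⟨ ⊕-cong (≋-reflexive (cong sumₚ (sym (map-∘ ss)))) (sum-cartesianProductWith c hc≋ ts ss) ⟩
  sumₚ (List.map (h ∘ c t) ss) ⊕ sumₚ (List.map u ts) ⊗ sumₚ (List.map v ss)
    ≈⟨ ⊕-cong (≋-trans (sum-map-cong (All.universal (hc≋ t) ss)) (sum-⊗ˡ (u t) v ss)) ≋-refl ⟩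
  u t ⊗ sumₚ (List.map v ss) ⊕ sumₚ (List.map u ts) ⊗ sumₚ (List.map v ss)
    ≈⟨ ⊗-distribʳ (u t) _ _ ⟨
  (u t ⊕ sumₚ (List.map u ts)) ⊗ sumₚ (List.map v ss) ∎
  where open ≋-Reasoning

sum-tabulate-≋ : ∀ {n} {s t : Fin n → Poly} → (∀ j → s j ≋ t j) → sumₚ (tabulate s) ≋ sumₚ (tabulate t)
sum-tabulate-≋ {zero}  e = ≋-refl
sum-tabulate-≋ {suc n} e = ⊕-cong (e zero) (sum-tabulate-≋ (e ∘ suc))

⊖-sum-tabulate : ∀ {n} (t : Fin n → Poly) → ⊖ sumₚ (tabulate t) ≋ sumₚ (tabulate (⊖_ ∘ t))
⊖-sum-tabulate {zero}  t = ≋-refl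
⊖-sum-tabulate {suc n} t = ≋-trans (⊖-⊕ (t zero) _) (⊕-cong ≋-refl (⊖-sum-tabulate (t ∘ suc)))

sum-applyUpTo-[] : ∀ {g : ℕ → Poly} n → (∀ j → g j ≋ []) → sumₚ (applyUpTo g n) ≋ []
sum-applyUpTo-[] zero    e = ≋-refl
sum-applyUpTo-[] (suc n) e = ⊕-cong (e 0) (sum-applyUpTo-[] n (e ∘ suc))

-- Products and reciprocals of power series

open RawRing (PowerSeries.rawRing ℤ[y]) using () renaming (_*_ to infixl 7 _⊛_)

⊛-monomial : ∀ (s t : Series) → s 0 ≋ [] → (∀ j → s (2 + j) ≋ []) → ∀ n → (s ⊛ t) (suc n) ≋ s 1 ⊗ t n
⊛-monomial s t s0 s2+ n = ≋-trans
  (⊕-cong {s 0 ⊗ t (suc n)} {[]} (⊗-cong s0 ≋-refl)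
    (⊕-cong {s 1 ⊗ t n} ≋-refl (sum-applyUpTo-[] n λ j → ⊗-cong (s2+ j) (≋-refl {t (n ∸ suc j)}))))
  (⊕-identityʳ (s 1 ⊗ t n))

x⊛ : ∀ (t : Series) n → (x ⊛ t) (suc n) ≋ t n
x⊛ t n = ≋-trans (⊛-monomial x t ≋-refl (λ _ → ≋-refl) n) (⊗-identityˡ (t n))

lookup-recipUpTo : ∀ s n j → lookup (recipUpTo s n) j ≡ recip s (n ∸ toℕ j)
lookup-recipUpTo s zero    zero    = refl
lookup-recipUpTo s (suc n) zero    = refl
lookup-recipUpTo s (suc n) (suc j) = lookup-recipUpTo s n j

-- With `s` read as `1 − x b`, this is the coefficient form of `t = 1 + x b t` for the reciprocal
-- `t`.
recip-suc : ∀ {s : Series} (b : ℕ → Poly) → (∀ j → s (suc j) ≋ ⊖ b j) → ∀ n →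
  recip s (suc n) ≋ sumₚ (tabulate {n = suc n} λ j → b (toℕ j) ⊗ recip s (n ∸ toℕ j))
recip-suc {s} b s≋ n = ≋-trans (⊖-sum-tabulate {suc n} λ j → s (suc (toℕ j)) ⊗ lookup (recipUpTo s n) j) (sum-tabulate-≋ {suc n} λ j → begin
  ⊖ (s (suc (toℕ j)) ⊗ lookup (recipUpTo s n) j)
    ≈⟨ ⊖-cong (⊗-cong (s≋ (toℕ j)) (≋-reflexive (lookup-recipUpTo s n j))) ⟩
  ⊖ (⊖ b (toℕ j) ⊗ recip s (n ∸ toℕ j))
    ≈⟨ ⊖-⊖⊗ (b (toℕ j)) _ ⟩
  b (toℕ j) ⊗ recip s (n ∸ toℕ j) ∎)
  where open ≋-Reasoning

-- The continued fraction and the tree series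

module _ (p : ℕ) where

  -- Level `i = suc q` of the fraction has exponent `q C p`, so it is paired with `weight q`.
  open ContinuedFraction (λ i → (i ∸ 1) C p) using (A)

  -- The coefficient of `x^n` in `G_q`, provided that `n ≤ fuel`.
  gf : ℕ → ℕ → ℕ → Poly
  gf fuel q n = sumₚ (List.map (y^ ∘ weight q p) (trees fuel n))

  -- When t is G_{q+1}, this is the coefficient of x^m in 1 + y^(q C p) (G_{q+1} − 1).

  leftFactor : ℕ → Series → ℕ → Poly
  leftFactor q t zero    = 1#
  leftFactor q t (suc m) = y^ (q C p) ⊗ t (suc m)

  -- The denominator `1 − x + x y^d − x y^d t` is regrouped as `1 − x (1 + y^d (t − 1))`.
  A-suc : ∀ l q m → A (suc l) (suc q) (suc m) ≋ ⊖ leftFactor q (recip (A l (2 + q))) m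
  A-suc l q m = ≋-trans (⊕-cong (⊕-cong {⊖ x (suc m)} ≋-refl (x⊛ (const y^d) m)) (⊖-cong xy^d⊛)) (lemma m)
    where
    y^d = y^ (q C p)
    t = recip (A l (2 + q))
    xy^d⊛ : ((x ⊛ const y^d) ⊛ t) (suc m) ≋ y^d ⊗ t m
    xy^d⊛ = ≋-trans (⊛-monomial (x ⊛ const y^d) t ≋-refl (λ j → x⊛ (const y^d) (suc j)) m)
                    (⊗-cong (x⊛ (const y^d) 0) (≋-refl {t m}))
    lemma : ∀ m → ⊖ x (suc m) ⊕ const y^d m ⊕ ⊖ (y^d ⊗ t m) ≋ ⊖ leftFactor q t m
    -- The reciprocal `t` has constant term `1`, so the two copies of `y^d` cancel.
    lemma zero = begin
      ⊖ 1# ⊕ y^d ⊕ ⊖ (y^d ⊗ 1#)    ≈⟨ ⊕-cong {⊖ 1# ⊕ y^d} ≋-refl (⊖-cong (⊗-identityʳ y^d)) ⟩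
      ⊖ 1# ⊕ y^d ⊕ ⊖ y^d           ≈⟨ ⊕-assoc (⊖ 1#) y^d _ ⟩
      ⊖ 1# ⊕ (y^d ⊕ ⊖ y^d)         ≈⟨ ⊕-cong {⊖ 1#} ≋-refl (⊕-inverseʳ y^d) ⟩
      ⊖ 1# ∎
      where open ≋-Reasoning
    lemma (suc m) = ≋-refl

  y^-weight-node : ∀ q l r → y^ (weight q p (node l r)) ≋
    y^ (sgn (size l) * (q C p) + weight (suc q) p l) ⊗ y^ (weight q p r)
  y^-weight-node q l r = ≋-trans (≋-reflexive (cong y^ (weight-node q p l r)))
    (y^-+ (sgn (size l) * (q C p) + weight (suc q) p l) (weight q p r))

  -- An empty left subtree contributes no factor `y^(q C p)`; this accounts for the separate
  -- constant term of `leftFactor`.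
  sum-left : ∀ fuel q m →
    sumₚ (List.map (λ l → y^ (sgn (size l) * (q C p) + weight (suc q) p l)) (trees fuel m)) ≋
    leftFactor q (gf fuel (suc q)) m
  sum-left fuel q zero    rewrite weight-leaf (suc q) p = ≋-refl
  sum-left fuel q (suc m) = ≋-trans (sum-map-cong (All.tabulate λ {l} l∈ → begin
      y^ (sgn (size l) * (q C p) + weight (suc q) p l)
        ≡⟨ cong (λ s → y^ (sgn s * (q C p) + weight (suc q) p l)) (∈-trees⁻ fuel (suc m) l∈) ⟩
      y^ (1 * (q C p) + weight (suc q) p l)
        ≡⟨ cong (λ d → y^ (d + weight (suc q) p l)) (*-identityˡ (q C p)) ⟩
      y^ (q C p + weight (suc q) p l)
        ≈⟨ y^-+ (q C p) (weight (suc q) p l) ⟩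
      y^ (q C p) ⊗ y^ (weight (suc q) p l) ∎))
    (sum-⊗ˡ (y^ (q C p)) (y^ ∘ weight (suc q) p) (trees fuel (suc m)))
    where open ≋-Reasoning

  -- The functional equation of `G_q` in coefficients, with `j` the size of the left subtree of the
  -- root.
  gf-suc : ∀ fuel q n → gf (suc fuel) q (suc n) ≋
    sumₚ (tabulate {n = suc n} λ j → leftFactor q (gf fuel (suc q)) (toℕ j) ⊗ gf fuel q (n ∸ toℕ j))
  gf-suc fuel q n = ≋-trans
    (sum-concat-tabulate (y^ ∘ weight q p) {suc n} (nodes fuel n ∘ toℕ))
    (sum-tabulate-≋ {suc n} λ j → ≋-trans
      (sum-cartesianProductWith node {h = y^ ∘ weight q p} (y^-weight-node q) (trees fuel (toℕ j)) (trees fuel (n ∸ toℕ j)))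
      (⊗-cong (sum-left fuel q (toℕ j)) ≋-refl))

  -- Both sides satisfy the same recursion. Each level of the fraction carries a factor `x`, so
  -- cutting it off after `l` levels does not affect coefficients up to `x^l`. The left factor moves
  -- to level `suc q` with one level fewer remaining, the right factor stays at `q`.
  recip-A≋gf : ∀ fuel {n l} q → n ≤ fuel → n ≤ l → recip (A l (suc q)) n ≋ gf fuel q n
  recip-A≋gf fuel       {zero}          q _         _         rewrite weight-leaf q p = ≋-refl
  recip-A≋gf (suc fuel) {suc n} {suc l} q (s≤s n≤f) (s≤s n≤l) = begin
    recip (A (suc l) (suc q)) (suc n)
      ≈⟨ recip-suc (leftFactor q (recip (A l (2 + q)))) (A-suc l q) n ⟩
    sumₚ (tabulate {n = suc n} λ j → leftFactor q (recip (A l (2 + q))) (toℕ j) ⊗ recip (A (suc l) (suc q)) (n ∸ toℕ j))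
      ≈⟨ sum-tabulate-≋ {suc n} (λ j → ⊗-cong (leftFactor≋ (toℕ j) (Finₚ.toℕ≤pred[n] j))
           (recip-A≋gf fuel q (≤-trans (m∸n≤m n (toℕ j)) n≤f) (≤-trans (m∸n≤m n (toℕ j)) (m≤n⇒m≤1+n n≤l)))) ⟩
    sumₚ (tabulate {n = suc n} λ j → leftFactor q (gf fuel (suc q)) (toℕ j) ⊗ gf fuel q (n ∸ toℕ j))
      ≈⟨ gf-suc fuel q n ⟨
    gf (suc fuel) q (suc n) ∎
    where
    open ≋-Reasoning
    leftFactor≋ : ∀ m → m ≤ n → leftFactor q (recip (A l (2 + q))) m ≋ leftFactor q (gf fuel (suc q)) m
    leftFactor≋ zero    _   = ≋-refl
    leftFactor≋ (suc m) m<n = ⊗-cong (≋-refl {y^ (q C p)}) (recip-A≋gf fuel (suc q) (≤-trans m<n n≤f) (≤-trans m<n n≤l))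

theorem2p1 : ∀ (k : ℕ) → 2 ≤ k →
    finiteFraction (λ i → (i ∸ 1) C (k ∸ 2)) ConvergesTo F (pattern12-3-⋯- k)
theorem2p1 (suc (suc k)) (s≤s (s≤s z≤n)) N = suc N , λ { (suc m) (s≤s N≤m) n n<N r → begin
  coeff (finiteFraction (λ i → (i ∸ 1) C k) (suc m) n) r
    -- `finiteFraction (suc m)` is the reciprocal of `A m 1`, with `m` levels, whence the threshold
    -- `suc N`. The weight at `q = 0` is `occᵗ k` by definition.
    ≡⟨ at (recip-A≋gf k n {n} {m} 0 ≤-refl (≤-trans (<⇒≤ n<N) N≤m)) r ⟩
  coeff (gf k n 0 n) r
    ≡⟨ coeff-sum-y^ (occᵗ k) (trees n n) r ⟩
  ℤ.+ length (filter (λ t → occᵗ k t ≟ r) (trees n n))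
    ≡⟨ cong ℤ.+_ (f≡trees k n r ≤-refl) ⟨
  ℤ.+ f (pattern12-3-⋯- (2 + k)) r n
    ≡⟨ coeff-F (pattern12-3-⋯- (2 + k)) n r ⟨
  coeff (F (pattern12-3-⋯- (2 + k)) n) r ∎ }
  where open ≡-Reasoning
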